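{- Let $\Delta\ge 3$ and let $A$ be a greedy adaptive priority algorithm in the vertex model. Then there is a graph $G$ with maximum degree at most $\Delta$ such that the matching computed by $A$ on $G$ has size at most $\frac{\Delta-1}{2\Delta-3}\,\nu(G)$.
   Context: $\nu(G)$ is the size of a maximum matching of a finite simple graph $G$. Vertex model: for a node $u$ with neighbors $v_1,\dots,v_d$ in the input graph, the data item of $u$ is $\langle u;v_1,\dots,v_d\rangle$; node identifiers come from a fixed universe. An adaptive priority algorithm proceeds in rounds; in each round it deterministically chooses, as a function only of the data items received and decisions made so far (without otherwise looking at the input), a total order $\pi$ on all possible data items, and receives the first data item (w.r.t. $\pi$) of the input whose node $u$ is still matchable (neither matched nor isolated); it then irrevocably either matches $u$ to a matchable neighbor or isolates $u$. This repeats until no matchable node with a matchable neighbor remains. It is greedy if it never isolates $u$, i.e., always matches $u$ to some matchable neighbor. -}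

module Defs where

open import Data.Nat using (ℕ; zero; suc; _+_; _*_; _∸_; _≤_; _<_; _≡ᵇ_)
open import Data.Bool using (Bool; true; false; not; _∧_; _∨_; if_then_else_)
open import Data.List using (List; []; _∷_; _++_; [_]; length; filterᵇ; map; concatMap)
open import Data.Bool.ListAction using (any)
open import Data.List.Relation.Unary.All using (All)
open import Data.List.Relation.Unary.Any using (Any)
open import Data.List.Relation.Unary.AllPairs using (AllPairs)
open import Data.List.Relation.Unary.Unique.Propositional using (Unique)
open import Data.List.Membership.Propositional using (_∈_)
open import Data.Product using (_×_; _,_; proj₁; proj₂)
open import Data.Sum using (_⊎_)
open import Relation.Binary.PropositionalEquality using (_≡_; _≢_)

record Graph : Set where
  field
    V       : List ℕ
    V-sorted : AllPairs _<_ V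
    adj     : ℕ → ℕ → Bool
    adj-sym : ∀ u v → adj u v ≡ adj v u
    adj-irr : ∀ u → adj u u ≡ false

open Graph public

nbrs : Graph → ℕ → List ℕ
nbrs G u = filterᵇ (adj G u) (V G)

MaxDegree≤ : Graph → ℕ → Set
MaxDegree≤ G Δ = All (λ u → length (nbrs G u) ≤ Δ) (V G)

endpoints : List (ℕ × ℕ) → List ℕ
endpoints = concatMap (λ e → proj₁ e ∷ proj₂ e ∷ [])

IsMatching : Graph → List (ℕ × ℕ) → Set
IsMatching G M =
  All (λ e → (proj₁ e ∈ V G) × (proj₂ e ∈ V G) × (adj G (proj₁ e) (proj₂ e) ≡ true)) M
  × Unique (endpoints M)

IsMaximumMatching : Graph → List (ℕ × ℕ) → Set
IsMaximumMatching G M = IsMatching G M × (∀ M′ → IsMatching G M′ → length M′ ≤ length M)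

DataItem : Set
DataItem = ℕ × List ℕ

dataItem : Graph → ℕ → DataItem
dataItem G u = (u , nbrs G u)

-- what the algorithm has seen so far: received data items together with
-- the neighbour each received node was matched to (chronological order)
History : Set
History = List (DataItem × ℕ)

matched : History → ℕ → Bool
matched h v = any (λ p → (proj₁ (proj₁ p) ≡ᵇ v) ∨ (proj₂ p ≡ᵇ v)) h

record GreedyAPA : Set where
  field
    prec       : History → DataItem → DataItem → Bool
    prec-irrefl : ∀ h x → prec h x x ≡ false
    prec-trans : ∀ h x y z → prec h x y ≡ true → prec h y z ≡ true → prec h x z ≡ true
    prec-total : ∀ h x y → x ≢ y → (prec h x y ≡ true) ⊎ (prec h y x ≡ true)
    choose     : History → DataItem → ℕ
    greedy     : ∀ h u ns → Any (λ v → matched h v ≡ false) ns →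
                 (choose h (u , ns) ∈ ns) × (matched h (choose h (u , ns)) ≡ false)

open GreedyAPA public

pickFirst : (DataItem → DataItem → Bool) → DataItem → List DataItem → DataItem
pickFirst lt x []       = x
pickFirst lt x (y ∷ ys) = pickFirst lt (if lt y x then y else x) ys

available : Graph → History → List ℕ
available G h =
  filterᵇ (λ u → not (matched h u) ∧ any (λ v → not (matched h v)) (nbrs G u)) (V G)

runFrom : GreedyAPA → Graph → ℕ → History → History
runFrom A G zero    h = h
runFrom A G (suc k) h with map (dataItem G) (available G h)
... | []     = h
... | c ∷ cs =
  let it = pickFirst (prec A h) c cs
  in runFrom A G k (h ++ [ (it , choose A h it) ])

-- the complete run (each round matches two new nodes, so |V| rounds suffice)
run : GreedyAPA → Graph → History
run A G = runFrom A G (length (V G)) []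

-- size of the matching computed by A on G (one matched edge per round)
algMatchingSize : GreedyAPA → Graph → ℕ
algMatchingSize A G = length (run A G)

-- The adversary fixes the graph lazily, only promising that every item that can
-- occur has at least two neighbours not involved in earlier rounds. Whenever x is
-- received and matched to y, the remaining fresh neighbours of x are joined to y
-- and to nothing else: removing {x, y} isolates them and costs the optimum two
-- edges. If there is only one such neighbour, y needs another partner later; it is
-- kept in a list O of nodes that later items may still contain, so that its last
-- neighbour cannot be told apart from the nodes that are sacrificed next. After
-- Δ - 3 such rounds, y becomes a hub of degree Δ next to a second hub c of degree Δ;
-- their Δ - 1 common neighbours Q serve O, y and c. What remains after this round is
-- a star at c, so A finds Δ - 1 edges, and 2Δ - 3 are possible.

module Submission where

open import Defs
open import Data.Bool using (Bool; true; false; _∨_; T)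
open import Data.Bool.Properties using (T-≡; T-∧; T-∨; T-not-≡)
open import Data.Empty using (⊥; ⊥-elim)
open import Data.List using (List; []; _∷_; _++_; [_]; length; filter; map; concatMap; cartesianProduct; upTo; zip)
open import Data.Nat
open import Data.Nat.Properties
open import Data.List.Membership.DecPropositional _≟_ using (_∈?_; _∉?_)
open import Data.List.Membership.Propositional using (_∈_; _∉_; find; lose)
open import Data.List.Membership.Propositional.Properties
open import Data.List.Properties using (length-++; length-upTo; ≡-dec; concatMap-++; length-zipWith)
open import Data.List.Relation.Binary.Subset.Propositional using (_⊆_)
open import Data.List.Relation.Unary.All as All using (All; []; _∷_)
open import Data.List.Relation.Unary.AllPairs using (AllPairs; []; _∷_)
import Data.List.Relation.Unary.AllPairs as AllPairs
import Data.List.Relation.Unary.AllPairs.Properties as AllPairs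
open import Data.List.Relation.Unary.Any using (Any; here; there; any?)
open import Data.List.Relation.Unary.Any.Properties using (any⁺; any⁻)
open import Data.List.Relation.Unary.Unique.Propositional using (Unique)
import Data.List.Relation.Unary.Unique.Propositional.Properties as Unique
open import Data.Product using (_×_; _,_; proj₁; proj₂; ∃-syntax)
open import Data.Product.Properties using () renaming (≡-dec to ×-≡-dec)
open import Data.Sum using (_⊎_; inj₁; inj₂; [_,_]′; swap)
open import Function using (_∘_; id; case_of_; mk⇔; Equivalence)
open import Relation.Binary.PropositionalEquality hiding ([_])
open import Relation.Nullary using (¬_; Dec; yes; no; does; contradiction)
open import Relation.Nullary.Decidable using (_×-dec_; _⊎-dec_; _→-dec_; ¬?; dec-true; dec-false; does-⇔; T?)

-- The order ranks all items, so control comes from a finite `pool` that contains the item of every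
-- node still available in any admissible completion. If `(x , ns)` is first in the pool and the
-- finished graph both shows this item and offers nothing outside the pool, the algorithm must
-- receive it. The finished graph is unknown during play, so the argument is carried backwards: an
-- `Outcome` for the state after a round becomes one for the state before it. Two fresh neighbours
-- are promised because one is lost to `y` and another must remain as the partner of `x` in the
-- large matching. The promise binds the adversary too: every node it adds must itself have two
-- fresh neighbours. With Δ = 3 + n, each of the n early rounds owes the large matching two edges,
-- either placed in `M` or pending at a node of `O`; the last round adds three, at `x`, `y` and `c`.
-- These 3 + 2n = 2Δ - 3 edges are optimal because the nodes matched in the first n + 1 rounds,
-- together with `c`, form a vertex cover of the same size.

private
  variable
    X : Set

remove-∈ : {x y : X} (as : List X) {bs : List X} → y ∈ as ++ x ∷ bs → y ≢ x → y ∈ as ++ bs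
remove-∈ as y∈ y≢x with ∈-++⁻ as y∈
... | inj₁ y∈as = ∈-++⁺ˡ y∈as
... | inj₂ (here y≡x) = contradiction y≡x y≢x
... | inj₂ (there y∈bs) = ∈-++⁺ʳ as y∈bs

Unique-⊆-length : {xs ys : List X} → Unique xs → xs ⊆ ys → length xs ≤ length ys
Unique-⊆-length {xs = []} _ _ = z≤n
Unique-⊆-length {xs = x ∷ xs} (x∉ ∷ uniq) sub with ∈-∃++ (sub (here refl))
... | as , bs , refl = begin
  suc (length xs)           ≤⟨ s≤s (Unique-⊆-length uniq sub′) ⟩
  suc (length (as ++ bs))   ≡⟨ cong suc (length-++ as) ⟩
  suc (length as + length bs) ≡⟨ +-suc (length as) (length bs) ⟨
  length as + suc (length bs) ≡⟨ length-++ as ⟨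
  length (as ++ x ∷ bs)     ∎
  where
  open ≤-Reasoning
  sub′ : xs ⊆ as ++ bs
  sub′ y∈ = remove-∈ as (sub (there y∈)) (λ y≡x → All.lookup x∉ y∈ (sym y≡x))

Ascending : List ℕ → Set
Ascending = AllPairs _<_

ascending-unique : {xs : List ℕ} → Ascending xs → Unique xs
ascending-unique = AllPairs.map <⇒≢

-- An item holds a neighbour list, not a set. Sortedness makes the list canonical, so items of a
-- graph and of the pool can be identified by comparing members.
ascending-ext : {xs ys : List ℕ} → Ascending xs → Ascending ys → xs ⊆ ys → ys ⊆ xs → xs ≡ ys
ascending-ext {[]} {[]} _ _ _ _ = refl
ascending-ext {[]} {y ∷ ys} _ _ _ g = case g (here refl) of λ ()
ascending-ext {x ∷ xs} {[]} _ _ f _ = case f (here refl) of λ ()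
ascending-ext {x ∷ xs} {y ∷ ys} (x< ∷ ax) (y< ∷ ay) f g = cong₂ _∷_ x≡y (ascending-ext ax ay f′ g′)
  where
  x≡y : x ≡ y
  x≡y with f (here refl) | g (here refl)
  ... | here p   | _        = p
  ... | there _  | here q   = sym q
  ... | there p  | there q  = contradiction (All.lookup y< p) (<-asym (All.lookup x< q))
  f′ : xs ⊆ ys
  f′ v∈ with f (there v∈)
  ... | here v≡y = contradiction (trans x≡y (sym v≡y)) (<⇒≢ (All.lookup x< v∈))
  ... | there r  = r
  g′ : ys ⊆ xs
  g′ v∈ with g (there v∈)
  ... | here v≡x = contradiction (trans (sym x≡y) (sym v≡x)) (<⇒≢ (All.lookup y< v∈))
  ... | there r  = r

sublists : List X → List (List X)
sublists []       = [] ∷ []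
sublists (x ∷ xs) = map (x ∷_) (sublists xs) ++ sublists xs

-- Neighbour lists in a graph on `upTo N` are filters of `upTo N`, so every item that such a graph
-- can show is among finitely many candidates.
filter-∈-sublists : {P : X → Set} (P? : ∀ x → Dec (P x)) (xs : List X) → filter P? xs ∈ sublists xs
filter-∈-sublists P? [] = here refl
filter-∈-sublists P? (x ∷ xs) with does (P? x)
... | true  = ∈-++⁺ˡ (∈-map⁺ (x ∷_) (filter-∈-sublists P? xs))
... | false = ∈-++⁺ʳ _ (filter-∈-sublists P? xs)

sublist-⊆ : (xs : List X) {ys : List X} → ys ∈ sublists xs → ys ⊆ xs
sublist-⊆ [] (here refl) v∈ = v∈
sublist-⊆ (x ∷ xs) ys∈ v∈ with ∈-++⁻ (map (x ∷_) (sublists xs)) ys∈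
... | inj₂ q = there (sublist-⊆ xs q v∈)
... | inj₁ p with ∈-map⁻ (x ∷_) p
...   | zs , zs∈ , refl with v∈
...     | here v≡x  = here v≡x
...     | there v∈′ = there (sublist-⊆ xs zs∈ v∈′)

sublist-ascending : (xs : List ℕ) {ys : List ℕ} → Ascending xs → ys ∈ sublists xs → Ascending ys
sublist-ascending [] _ (here refl) = []
sublist-ascending (x ∷ xs) (x< ∷ a) ys∈ with ∈-++⁻ (map (x ∷_) (sublists xs)) ys∈
... | inj₂ q = sublist-ascending xs a q
... | inj₁ p with ∈-map⁻ (x ∷_) p
...   | zs , zs∈ , refl = All.tabulate (λ v∈ → All.lookup x< (sublist-⊆ xs zs∈ v∈)) ∷ sublist-ascending xs a zs∈

upTo-ascending : ∀ N → Ascending (upTo N)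
upTo-ascending N = AllPairs.applyUpTo⁺₁ id N (λ i<j _ → i<j)

fresh-label : ∀ N (U : List ℕ) → length U < N → ∃[ v ] v < N × v ∉ U
fresh-label N U U<N with any? (_∉? U) (upTo N)
... | yes p = let v , v∈ , v∉ = find p in v , ∈-upTo⁻ v∈ , v∉
... | no ¬p = contradiction U<N (≤⇒≯ (subst (_≤ length U) (length-upTo N)
                (Unique-⊆-length (Unique.upTo⁺ N) sub)))
  where
  sub : upTo N ⊆ U
  sub {v} v∈ with v ∈? U
  ... | yes v∈U = v∈U
  ... | no v∉U  = contradiction (lose v∈ v∉U) ¬p

fresh-labels : ∀ N (U : List ℕ) m → m + length U ≤ N →
  ∃[ F ] length F ≡ m × Unique F × (∀ {v} → v ∈ F → v < N × v ∉ U)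
fresh-labels N U zero _ = [] , refl , [] , λ ()
fresh-labels N U (suc m) le with fresh-label N U (≤-trans (s≤s (m≤n+m _ m)) le)
... | v , v<N , v∉U with fresh-labels N (v ∷ U) m (subst (_≤ N) (sym (+-suc m (length U))) le)
...   | F , len , uniq , fresh =
        v ∷ F , cong suc len
        , All.tabulate (λ w∈ v≡w → proj₂ (fresh w∈) (here (sym v≡w))) ∷ uniq
        , λ { (here refl) → v<N , v∉U ; (there w∈) → proj₁ (fresh w∈) , proj₂ (fresh w∈) ∘ there }

-- First items in a strict total order

module _ (lt : DataItem → DataItem → Bool)
         (lt-irrefl : ∀ x → lt x x ≡ false)
         (lt-trans : ∀ x y z → lt x y ≡ true → lt y z ≡ true → lt x z ≡ true)
         (lt-total : ∀ x y → x ≢ y → (lt x y ≡ true) ⊎ (lt y x ≡ true)) where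

  private
    true≢false : {b : Bool} → b ≡ true → b ≡ false → ⊥
    true≢false refl ()

    ≢true : {b : Bool} → b ≢ true → b ≡ false
    ≢true {true}  f = ⊥-elim (f refl)
    ≢true {false} _ = refl

    _≟ᴵ_ : (x y : DataItem) → Dec (x ≡ y)
    _≟ᴵ_ = ×-≡-dec _≟_ (≡-dec _≟_)

  pickFirst-∈ : ∀ c cs → pickFirst lt c cs ∈ c ∷ cs
  pickFirst-∈ c [] = here refl
  pickFirst-∈ c (d ∷ ds) with lt d c
  ... | true  = there (pickFirst-∈ d ds)
  ... | false with pickFirst-∈ c ds
  ...   | here p  = here p
  ...   | there p = there (there p)

  pickFirst-min : ∀ c cs {z} → z ∈ c ∷ cs → lt z (pickFirst lt c cs) ≡ false
  pickFirst-min c [] (here refl) = lt-irrefl c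
  pickFirst-min c (d ∷ ds) z∈ with lt d c in eq
  pickFirst-min c (d ∷ ds) (here refl) | true =
    ≢true (λ c<m → true≢false (lt-trans d c _ eq c<m) (pickFirst-min d ds (here refl)))
  pickFirst-min c (d ∷ ds) (there z∈) | true = pickFirst-min d ds z∈
  pickFirst-min c (d ∷ ds) (here refl) | false = pickFirst-min c ds (here refl)
  pickFirst-min c (d ∷ ds) (there (there z∈)) | false = pickFirst-min c ds (there z∈)
  -- Here `d` was compared only with `c`, not with the final pick `m`. If `m` differs from `c`,
  -- totality and the minimality of `m` put `m` before `c`, and then `d` before `m` would give `d`
  -- before `c`.
  pickFirst-min c (d ∷ ds) (there (here refl)) | false = ≢true λ d<m → d≮m d<m (pickFirst lt c ds ≟ᴵ c)
    where
    d≮m : lt d (pickFirst lt c ds) ≡ true → Dec (pickFirst lt c ds ≡ c) → ⊥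
    d≮m d<m (yes m≡c) = true≢false (trans (cong (lt d) (sym m≡c)) d<m) eq
    d≮m d<m (no m≢c) with lt-total _ _ m≢c
    ... | inj₁ m<c = true≢false (lt-trans d _ c d<m m<c) eq
    ... | inj₂ c<m = true≢false c<m (pickFirst-min c ds (here refl))

  -- Totality leaves room for only one minimal element, so the pick does not depend on how the list
  -- is arranged. An item that is first in the whole pool is therefore the pick from any part of the
  -- pool containing it.
  pickFirst-unique : ∀ c cs {m} → m ∈ c ∷ cs → (∀ {z} → z ∈ c ∷ cs → lt z m ≡ false) → pickFirst lt c cs ≡ m
  pickFirst-unique c cs {m} m∈ m-min with pickFirst lt c cs ≟ᴵ m
  ... | yes eq = eq
  ... | no neq with lt-total _ _ neq
  ...   | inj₁ p = ⊥-elim (true≢false p (m-min (pickFirst-∈ c cs)))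
  ...   | inj₂ p = ⊥-elim (true≢false p (pickFirst-min c cs m∈))

-- Matched nodes and runs of the algorithm

ends : History → List ℕ
ends = concatMap (λ p → proj₁ (proj₁ p) ∷ proj₂ p ∷ [])

ends-∷ʳ : ∀ h x ns y → ends (h ++ [ ((x , ns) , y) ]) ≡ ends h ++ x ∷ y ∷ []
ends-∷ʳ h x ns y = concatMap-++ _ h _

length-ends : ∀ h → length (ends h) ≡ 2 * length h
length-ends [] = refl
length-ends (p ∷ h) = trans (cong (2 +_) (length-ends h)) (sym (*-suc 2 (length h)))

matched⇒∈ : ∀ h {v} → matched h v ≡ true → v ∈ ends h
matched⇒∈ h {v} eq = go h (any⁻ _ h (Equivalence.from T-≡ eq))
  where
  go : ∀ h → Any _ h → v ∈ ends h
  go (((x , ns) , y) ∷ h) (here px) with Equivalence.to (T-∨ {x ≡ᵇ v}) px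
  ... | inj₁ p = here (sym (≡ᵇ⇒≡ x v p))
  ... | inj₂ p = there (here (sym (≡ᵇ⇒≡ y v p)))
  go (_ ∷ h) (there p) = there (there (go h p))

∈⇒matched : ∀ h {v} → v ∈ ends h → matched h v ≡ true
∈⇒matched h {v} v∈ = Equivalence.to T-≡ (any⁺ _ (go h v∈))
  where
  go : ∀ h → v ∈ ends h → Any (λ p → T ((proj₁ (proj₁ p) ≡ᵇ v) ∨ (proj₂ p ≡ᵇ v))) h
  go (((x , ns) , y) ∷ h) (here refl) = here (Equivalence.from T-∨ (inj₁ (≡⇒≡ᵇ x x refl)))
  go (((x , ns) , y) ∷ h) (there (here refl)) = here (Equivalence.from (T-∨ {x ≡ᵇ v}) (inj₂ (≡⇒≡ᵇ y y refl)))
  go (_ ∷ h) (there (there p)) = there (go h p)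

unmatched⇒∉ : ∀ h {v} → matched h v ≡ false → v ∉ ends h
unmatched⇒∉ h eq v∈ with () ← trans (sym eq) (∈⇒matched h v∈)

∉⇒unmatched : ∀ h {v} → v ∉ ends h → matched h v ≡ false
∉⇒unmatched h {v} v∉ with matched h v in eq
... | true  = contradiction (matched⇒∈ h eq) v∉
... | false = refl

∈-available⁻ : ∀ G h {u} → u ∈ available G h →
  u ∈ V G × u ∉ ends h × ∃[ v ] v ∈ nbrs G u × v ∉ ends h
∈-available⁻ G h {u} u∈ with ∈-filter⁻ (T? ∘ _) {xs = V G} u∈
... | u∈V , t with Equivalence.to T-∧ t
...   | tu , tv with find (any⁻ _ (nbrs G u) tv)
...     | v , v∈ , tw = u∈V , unmatched⇒∉ h (Equivalence.to T-not-≡ tu) , v , v∈ , unmatched⇒∉ h (Equivalence.to T-not-≡ tw)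

∈-available⁺ : ∀ G h {u v} → u ∈ V G → u ∉ ends h → v ∈ nbrs G u → v ∉ ends h → u ∈ available G h
∈-available⁺ G h u∈V u∉ v∈ v∉ = ∈-filter⁺ (T? ∘ _) u∈V (Equivalence.from T-∧
  ( Equivalence.from T-not-≡ (∉⇒unmatched h u∉)
  , any⁺ _ (lose v∈ (Equivalence.from T-not-≡ (∉⇒unmatched h v∉)))))

runFrom-pick : ∀ A G f h {it} →
  it ∈ map (dataItem G) (available G h) →
  (∀ {z} → z ∈ map (dataItem G) (available G h) → prec A h z it ≡ false) →
  runFrom A G (suc f) h ≡ runFrom A G f (h ++ [ (it , choose A h it) ])
runFrom-pick A G f h it∈ it-min with map (dataItem G) (available G h)
... | c ∷ cs = cong (λ m → runFrom A G f (h ++ [ (m , choose A h m) ]))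
  (pickFirst-unique (prec A h) (prec-irrefl A h) (prec-trans A h) (prec-total A h) c cs it∈ it-min)

runFrom-stop : ∀ A G f h → (∀ {u} → u ∉ available G h) → runFrom A G f h ≡ h
runFrom-stop A G zero h none = refl
runFrom-stop A G (suc f) h none with available G h
... | []    = refl
... | u ∷ _ = contradiction (here refl) none

length-∷ʳ : (xs : List X) {x : X} → length (xs ++ [ x ]) ≡ suc (length xs)
length-∷ʳ xs = trans (length-++ xs) (+-comm (length xs) 1)

-- Once the unmatched nodes span only a star centred at c, at most one more edge is chosen.
runFrom-star : ∀ A G f h c →
  (∀ {u v} → v ∈ nbrs G u → u ∉ ends h → v ∉ ends h → u ≡ c ⊎ v ≡ c) →
  length (runFrom A G f h) ≤ suc (length h)
runFrom-star A G zero h c star = n≤1+n _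
runFrom-star A G (suc f) h c star with map (dataItem G) (available G h) in eq
... | []     = n≤1+n _
... | d ∷ ds = ≤-reflexive (trans (cong length (runFrom-stop A G f h′ none)) (length-∷ʳ h))
  where
  it = pickFirst (prec A h) d ds
  y  = choose A h it
  h′ = h ++ [ (it , y) ]
  it∈ : it ∈ map (dataItem G) (available G h)
  it∈ = subst (it ∈_) (sym eq) (pickFirst-∈ (prec A h) (prec-irrefl A h) (prec-trans A h) (prec-total A h) d ds)
  -- Greediness makes the chosen edge join two unmatched nodes, so it belongs to the star and uses
  -- up its centre.
  c∈ : c ∈ ends h′
  c∈ with ∈-map⁻ (dataItem G) it∈
  ... | u , u∈ , it≡ with ∈-available⁻ G h u∈
  ...   | _ , u∉ , v , v∈ , v∉ with greedy A h u (nbrs G u) (lose v∈ (∉⇒unmatched h v∉))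
  ...     | w∈ , w-un = subst (c ∈_) (sym (ends-∷ʳ h _ _ _)) (∈-++⁺ʳ (ends h) c∈′)
    where
    y≡ : choose A h (u , nbrs G u) ≡ y
    y≡ = cong (choose A h) (sym it≡)
    c∈′ : c ∈ proj₁ it ∷ y ∷ []
    c∈′ with star w∈ u∉ (unmatched⇒∉ h w-un)
    ... | inj₁ u≡c = here (trans (sym u≡c) (cong proj₁ (sym it≡)))
    ... | inj₂ w≡c = there (here (trans (sym w≡c) y≡))
  old : ∀ {v} → v ∉ ends h′ → v ∉ ends h
  old v∉ v∈ = v∉ (subst (_ ∈_) (sym (ends-∷ʳ h _ _ _)) (∈-++⁺ˡ v∈))
  none : ∀ {u} → u ∉ available G h′
  none u∈ with ∈-available⁻ G h′ u∈
  ... | _ , u∉ , v , v∈ , v∉ with star v∈ (old u∉) (old v∉)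
  ...   | inj₁ refl = u∉ c∈
  ...   | inj₂ refl = v∉ c∈

-- Graphs given by edge lists

Edges : Set
Edges = List (ℕ × ℕ)

-- Loops are discarded and both orientations count, so every list of pairs defines a simple graph
-- and edges are added by concatenation without side conditions.
Adj : Edges → ℕ → ℕ → Set
Adj E u v = u ≢ v × ((u , v) ∈ E ⊎ (v , u) ∈ E)

Adj-sym : ∀ {E u v} → Adj E u v → Adj E v u
Adj-sym (u≢v , e) = u≢v ∘ sym , swap e

module _ (E : Edges) where
  open import Data.List.Membership.DecPropositional (×-≡-dec _≟_ _≟_) using () renaming (_∈?_ to _∈ᴱ?_)

  adj? : ∀ u v → Dec (Adj E u v)
  adj? u v = ¬? (u ≟ v) ×-dec ((u , v) ∈ᴱ? E ⊎-dec (v , u) ∈ᴱ? E)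

graph : ℕ → Edges → Graph
graph N E = record
  { V        = upTo N
  ; V-sorted = upTo-ascending N
  ; adj      = λ u v → does (adj? E u v)
  ; adj-sym  = λ u v → does-⇔ (mk⇔ Adj-sym Adj-sym) (adj? E u v) (adj? E v u)
  ; adj-irr  = λ u → dec-false (adj? E u u) (λ a → proj₁ a refl)
  }

does⇒ : {P : Set} (P? : Dec P) → does P? ≡ true → P
does⇒ (yes p) _ = p

∈-nbrs⁻ : ∀ N E {u v} → v ∈ nbrs (graph N E) u → v < N × Adj E u v
∈-nbrs⁻ N E {u} {v} v∈ with ∈-filter⁻ (T? ∘ adj (graph N E) u) {xs = upTo N} v∈
... | v∈V , t = ∈-upTo⁻ v∈V , does⇒ (adj? E u v) (Equivalence.to T-≡ t)

∈-nbrs⁺ : ∀ N E {u v} → v < N → Adj E u v → v ∈ nbrs (graph N E) u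
∈-nbrs⁺ N E {u} {v} v<N a =
  ∈-filter⁺ (T? ∘ adj (graph N E) u) (∈-upTo⁺ v<N) (Equivalence.from T-≡ (dec-true (adj? E u v) a))

nbrs-ascending : ∀ N E u → Ascending (nbrs (graph N E) u)
nbrs-ascending N E u = AllPairs.filter⁺ (T? ∘ adj (graph N E) u) (upTo-ascending N)

degree-≤ : ∀ N E u {L} → (∀ {v} → Adj E u v → v ∈ L) → length (nbrs (graph N E) u) ≤ length L
degree-≤ N E u sub = Unique-⊆-length (ascending-unique (nbrs-ascending N E u)) (sub ∘ proj₂ ∘ ∈-nbrs⁻ N E)

dataItem-≡ : ∀ N E {x ns} → Ascending ns → (∀ {v} → v ∈ ns → v < N × Adj E x v) →
  (∀ {v} → Adj E x v → v ∈ ns) → dataItem (graph N E) x ≡ (x , ns)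
dataItem-≡ N E {x} asc to from = cong (x ,_) (ascending-ext (nbrs-ascending N E x) asc
  (from ∘ proj₂ ∘ ∈-nbrs⁻ N E) (λ v∈ → ∈-nbrs⁺ N E (proj₁ (to v∈)) (proj₂ (to v∈))))

-- The easy half of matching-cover duality: picking a covered endpoint from each matching edge
-- yields distinct members of `C`. This is how optimality is certified without inspecting other
-- matchings.
matching-≤-cover : ∀ N E C → (∀ {u v} → Adj E u v → u ∈ C ⊎ v ∈ C) →
  ∀ M → IsMatching (graph N E) M → length M ≤ length C
matching-≤-cover N E C cover M (M⊆E , uniq) = let cs , len , sub , _ , cs! = select M M⊆E uniq in
  subst (_≤ length C) len (Unique-⊆-length cs! sub)
  where
  select : ∀ M → All _ M → Unique (endpoints M) →
    ∃[ cs ] length cs ≡ length M × cs ⊆ C × cs ⊆ endpoints M × Unique cs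
  select [] _ _ = [] , refl , (λ ()) , (λ ()) , []
  select ((a , b) ∷ M) ((_ , _ , ab) ∷ edges) (a# ∷ b# ∷ uniq) with select M edges uniq
  ... | cs , len , sub , sub′ , cs! with cover (does⇒ (adj? E a b) ab)
  ...   | inj₁ a∈C = a ∷ cs , cong suc len , (λ { (here refl) → a∈C ; (there p) → sub p })
                   , (λ { (here refl) → here refl ; (there p) → there (there (sub′ p)) })
                   , All.tabulate (λ p → All.lookup a# (there (sub′ p))) ∷ cs!
  ...   | inj₂ b∈C = b ∷ cs , cong suc len , (λ { (here refl) → b∈C ; (there p) → sub p })
                   , (λ { (here refl) → there (here refl) ; (there p) → there (there (sub′ p)) })
                   , All.tabulate (λ p → All.lookup b# (sub′ p)) ∷ cs!

-- Stars and zipped pairs as building blocks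

star : ℕ → List ℕ → Edges
star c vs = map (c ,_) vs

∈-star⁺ : ∀ {c v vs} → v ∈ vs → (c , v) ∈ star c vs
∈-star⁺ = ∈-map⁺ _

∈-star⁻ : ∀ {c a b vs} → (a , b) ∈ star c vs → a ≡ c × b ∈ vs
∈-star⁻ p with ∈-map⁻ _ p
... | _ , b∈ , refl = refl , b∈

Adj-++⁻ : ∀ E {E′ u v} → Adj (E ++ E′) u v → Adj E u v ⊎ Adj E′ u v
Adj-++⁻ E (u≢v , inj₁ e) = [ (λ p → inj₁ (u≢v , inj₁ p)) , (λ p → inj₂ (u≢v , inj₁ p)) ]′ (∈-++⁻ E e)
Adj-++⁻ E (u≢v , inj₂ e) = [ (λ p → inj₁ (u≢v , inj₂ p)) , (λ p → inj₂ (u≢v , inj₂ p)) ]′ (∈-++⁻ E e)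

Adj-star⁻ : ∀ {c vs u v} → Adj (star c vs) u v → (u ≡ c × v ∈ vs) ⊎ (v ≡ c × u ∈ vs)
Adj-star⁻ (_ , inj₁ e) = inj₁ (∈-star⁻ e)
Adj-star⁻ (_ , inj₂ e) = inj₂ (∈-star⁻ e)

∈-zip⁻ : ∀ xs ys {a b : ℕ} → (a , b) ∈ zip xs ys → a ∈ xs × b ∈ ys
∈-zip⁻ (x ∷ xs) (y ∷ ys) (here refl) = here refl , here refl
∈-zip⁻ (x ∷ xs) (y ∷ ys) (there p) = let q , r = ∈-zip⁻ xs ys p in there q , there r

-- For degree counting: pairing off a repetition-free list costs each of its nodes at most one edge.
zip-partnerˡ : ∀ {xs : List ℕ} (ys : List ℕ) → Unique xs → ∀ a → ∃[ L ] length L ≤ 1 × (∀ {b} → (a , b) ∈ zip xs ys → b ∈ L)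
zip-partnerˡ {[]} _ _ a = [] , z≤n , λ ()
zip-partnerˡ {_ ∷ _} [] _ a = [] , z≤n , λ ()
zip-partnerˡ {x ∷ xs} (y ∷ ys) (x# ∷ xs!) a with a ≟ x | zip-partnerˡ ys xs! a
... | no a≢x | L , len , cover = L , len , tail
  where
  tail : ∀ {b} → (a , b) ∈ zip (x ∷ xs) (y ∷ ys) → b ∈ L
  tail (here refl) = contradiction refl a≢x
  tail (there p)   = cover p
... | yes refl | _ = [ y ] , ≤-refl , head
  where
  head : ∀ {b} → (x , b) ∈ zip (x ∷ xs) (y ∷ ys) → b ∈ [ y ]
  head (here refl) = here refl
  head (there p)   = contradiction refl (All.lookup x# (proj₁ (∈-zip⁻ xs ys p)))

∈-endpoints-zip⁻ : ∀ xs ys {a} → a ∈ endpoints (zip xs ys) → a ∈ xs ⊎ a ∈ ys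
∈-endpoints-zip⁻ (x ∷ xs) (y ∷ ys) (here refl) = inj₁ (here refl)
∈-endpoints-zip⁻ (x ∷ xs) (y ∷ ys) (there (here refl)) = inj₂ (here refl)
∈-endpoints-zip⁻ (x ∷ xs) (y ∷ ys) (there (there p)) with ∈-endpoints-zip⁻ xs ys p
... | inj₁ q = inj₁ (there q)
... | inj₂ q = inj₂ (there q)

endpoints-zip-unique : ∀ {xs ys} → Unique xs → Unique ys → (∀ {v} → v ∈ xs → v ∉ ys) →
  Unique (endpoints (zip xs ys))
endpoints-zip-unique {[]} _ _ _ = []
endpoints-zip-unique {_ ∷ _} {[]} _ _ _ = []
endpoints-zip-unique {x ∷ xs} {y ∷ ys} (x# ∷ xs!) (y# ∷ ys!) disj =
  All.tabulate x-new ∷ All.tabulate y-new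
    ∷ endpoints-zip-unique xs! ys! (λ p q → disj (there p) (there q))
  where
  x-new : ∀ {v} → v ∈ y ∷ endpoints (zip xs ys) → x ≢ v
  x-new (here refl) refl = disj (here refl) (here refl)
  x-new (there p) refl with ∈-endpoints-zip⁻ xs ys p
  ... | inj₁ q = All.lookup x# q refl
  ... | inj₂ q = disj (here refl) (there q)
  y-new : ∀ {v} → v ∈ endpoints (zip xs ys) → y ≢ v
  y-new p refl with ∈-endpoints-zip⁻ xs ys p
  ... | inj₁ q = disj (there q) (here refl)
  ... | inj₂ q = All.lookup y# q refl

abstract
  infixl 6 _∖_

  _∖_ : List ℕ → List ℕ → List ℕ
  ns ∖ U = filter (_∉? U) ns

  ∈-∖⁺ : ∀ ns {U v} → v ∈ ns → v ∉ U → v ∈ ns ∖ U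
  ∈-∖⁺ ns {U} = ∈-filter⁺ (_∉? U)

  ∈-∖⁻ : ∀ ns {U v} → v ∈ ns ∖ U → v ∈ ns × v ∉ U
  ∈-∖⁻ ns {U} = ∈-filter⁻ (_∉? U) {xs = ns}

  ∖-unique : ∀ {ns U} → Unique ns → Unique (ns ∖ U)
  ∖-unique {_} {U} = Unique.filter⁺ (_∉? U)

-- The adversary's game: pool, states and admissible completions

module Game (n N : ℕ) (A : GreedyAPA) where

  Δ : ℕ
  Δ = 3 + n

  Fresh₂ : List ℕ → List ℕ → Set
  Fresh₂ U ns = Any (λ a → Any (λ b → a ≢ b × a ∉ U × b ∉ U) ns) ns

  fresh₂⁻ : ∀ {U ns} → Fresh₂ U ns →
    ∃[ a ] ∃[ b ] a ≢ b × (a ∈ ns × a ∉ U) × (b ∈ ns × b ∉ U)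
  fresh₂⁻ p with find p
  ... | a , a∈ , q with find q
  ...   | b , b∈ , a≢b , a∉ , b∉ = a , b , a≢b , (a∈ , a∉) , (b∈ , b∉)

  fresh₂⁺ : ∀ {U ns a b} → a ≢ b → a ∈ ns → a ∉ U → b ∈ ns → b ∉ U → Fresh₂ U ns
  fresh₂⁺ a≢b a∈ a∉ b∈ b∉ = lose a∈ (lose b∈ (a≢b , a∉ , b∉))

  -- All that the adversary promises about items not yet received. Used neighbours must lie in `O`,
  -- whose nodes alone still accept edges. Every clause is decidable, so that the pool can be cut
  -- out by `filter`.
  Valid : List ℕ → List ℕ → DataItem → Set
  Valid U O (x , ns) =
    x ∉ U × x ∉ ns × All (λ a → a ∈ U → a ∈ O) ns × length ns ≤ Δ × Fresh₂ U ns

  valid? : ∀ U O it → Dec (Valid U O it)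
  valid? U O (x , ns) =
    (x ∉? U) ×-dec (x ∉? ns) ×-dec All.all? (λ a → (a ∈? U) →-dec (a ∈? O)) ns
      ×-dec (length ns ≤? Δ)
      ×-dec any? (λ a → any? (λ b → ¬? (a ≟ b) ×-dec (a ∉? U) ×-dec (b ∉? U)) ns) ns

  abstract
    pool : List ℕ → List ℕ → List DataItem
    pool U O = filter (valid? U O) (cartesianProduct (upTo N) (sublists (upTo N)))

    ∈-pool⁻ : ∀ U O {x ns} → (x , ns) ∈ pool U O →
      x < N × Ascending ns × (∀ {v} → v ∈ ns → v < N) × Valid U O (x , ns)
    ∈-pool⁻ U O it∈ with ∈-filter⁻ (valid? U O) {xs = cartesianProduct (upTo N) (sublists (upTo N))} it∈
    ... | p , valid with ∈-cartesianProduct⁻ (upTo N) (sublists (upTo N)) p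
    ...   | x∈ , ns∈ = ∈-upTo⁻ x∈ , sublist-ascending (upTo N) (upTo-ascending N) ns∈
                     , ∈-upTo⁻ ∘ sublist-⊆ (upTo N) ns∈ , valid

    ∈-pool⁺ : ∀ U O {x} {P : ℕ → Set} (P? : ∀ v → Dec (P v)) → x < N →
      Valid U O (x , filter P? (upTo N)) → (x , filter P? (upTo N)) ∈ pool U O
    ∈-pool⁺ U O P? x<N valid = ∈-filter⁺ (valid? U O)
      (∈-cartesianProduct⁺ (∈-upTo⁺ x<N) (filter-∈-sublists P? (upTo N))) valid

  -- State with r rounds to go before the last one: U are the labels used so far,
  -- O the nodes still waiting for a partner, E the edges fixed so far, and M the
  -- part of the large matching built so far. In deg, the spare 2 + r is for one
  -- edge per remaining round, one in the last round, and one to the partner.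
  record Invariant (r : ℕ) (h : History) (U O : List ℕ) (E M : Edges) : Set where
    field
      U<N    : ∀ {v} → v ∈ U → v < N
      K⊆U    : ends h ⊆ U
      O⊆K    : O ⊆ ends h
      O!     : Unique O
      E⊆U    : ∀ {a b} → (a , b) ∈ E → a ∈ U × b ∈ U
      E-cov  : ∀ {a b} → (a , b) ∈ E → a ∈ ends h ⊎ b ∈ ends h
      deg    : ∀ {u} → u ∈ U → ∃[ L ] (∀ {v} → Adj E u v → v ∈ L)
                 × length L ≤ Δ × (u ∈ O → length L + (2 + r) ≤ Δ)
      M!     : Unique (endpoints M)
      M⊆U    : ∀ {v} → v ∈ endpoints M → v ∈ U × v ∉ O
      M⊆E    : ∀ {a b} → (a , b) ∈ M → (a , b) ∈ E × a ≢ b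
      M-size : length M + length O ≡ 2 * length h
      O-size : length O ≤ length h
      rounds : length h + r ≡ n
      budget : length U + (suc r * suc Δ + Δ) ≤ N

  -- F is an admissible completion of E: up to now it looks like E to the algorithm,
  -- and spread puts the items of all non-isolated unused nodes into the pool.
  record Extends (U O : List ℕ) (E F : Edges) : Set where
    field
      E⊆F    : E ⊆ F
      closed : ∀ {u v} → u ∈ U → Adj F u v → Adj E u v ⊎ (u ∈ O × v ∉ U)
      spread : ∀ {u v} → u ∉ U → Adj F u v →
        ∃[ a ] ∃[ b ] a ≢ b × (a ∉ U × a < N × Adj F u a) × (b ∉ U × b < N × Adj F u b)

  -- Here `3 + 2 * n` is 2Δ - 3. A matching and a cover of this common size certify each other as
  -- optimal.
  record Final (F : Edges) : Set where
    field
      degrees  : ∀ u → ∃[ L ] (∀ {v} → Adj F u v → v ∈ L) × length L ≤ Δ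
      matching : ∃[ M ] IsMatching (graph N F) M × length M ≡ 3 + 2 * n
      cover    : ∃[ C ] (∀ {u v} → Adj F u v → u ∈ C ⊎ v ∈ C) × length C ≡ 3 + 2 * n

  -- The pair (x , ns) is the first item of the pool, y the neighbour chosen for x,
  -- and z ∷ R lists the other fresh neighbours of x.
  record Pick (h : History) (U O : List ℕ) : Set where
    field
      x     : ℕ
      ns    : List ℕ
      z     : ℕ
      R     : List ℕ

    y : ℕ
    y = choose A h (x , ns)

    field
      x<N    : x < N
      x∉U    : x ∉ U
      x∉ns   : x ∉ ns
      ns<N   : ∀ {v} → v ∈ ns → v < N
      ns-asc : Ascending ns
      ns-old : ∀ {v} → v ∈ ns → v ∈ U → v ∈ O
      ns≤Δ   : length ns ≤ Δ
      fresh₂ : Fresh₂ U ns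
      y∈ns   : y ∈ ns
      y∉U    : y ∉ U
      rest⁻  : ∀ {v} → v ∈ z ∷ R → v ∈ ns × v ∉ U × v ≢ y
      rest⁺  : ∀ {v} → v ∈ ns → v ∉ U → v ≢ y → v ∈ z ∷ R
      rest!  : Unique (z ∷ R)
      first  : ∀ {it} → it ∈ pool U O → prec A h it (x , ns) ≡ false

    x≢y : x ≢ y
    x≢y x≡y = x∉ns (subst (_∈ ns) (sym x≡y) y∈ns)

    rest≤ns : 2 + length R ≤ length ns
    rest≤ns = Unique-⊆-length (All.tabulate (λ v∈ y≡v → proj₂ (proj₂ (rest⁻ v∈)) (sym y≡v)) ∷ rest!)
      (λ { (here refl) → y∈ns ; (there v∈) → proj₁ (rest⁻ v∈) })

    U′ : List ℕ
    U′ = x ∷ ns ++ U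

    data Region : ℕ → Set where
      at-x  : Region x
      at-y  : Region y
      rest  : ∀ {u} → u ∈ z ∷ R → Region u
      old   : ∀ {u} → u ∈ U → Region u

    region : ∀ {u} → u ∈ U′ → Region u
    region (here refl) = at-x
    region {u} (there u∈) with u ∈? U | u ≟ y
    ... | yes u∈U | _ = old u∈U
    ... | no _    | yes refl = at-y
    ... | no u∉U  | no u≢y with ∈-++⁻ ns u∈
    ...   | inj₁ u∈ns = rest (rest⁺ u∈ns u∉U u≢y)
    ...   | inj₂ u∈U  = contradiction u∈U u∉U

    U⊆U′ : U ⊆ U′
    U⊆U′ = there ∘ ∈-++⁺ʳ ns

    ns⊆U′ : ns ⊆ U′
    ns⊆U′ = there ∘ ∈-++⁺ˡ

    U′<N : (∀ {v} → v ∈ U → v < N) → ∀ {v} → v ∈ U′ → v < N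
    U′<N U<N (here refl) = x<N
    U′<N U<N (there v∈) = [ ns<N , U<N ]′ (∈-++⁻ ns v∈)

  pool-inhabited : ∀ U O → 3 + length U ≤ N → ∃[ it ] it ∈ pool U O
  pool-inhabited U O room = go (fresh-labels N U 3 room)
    where
    go : ∃[ F ] length F ≡ 3 × Unique F × (∀ {v} → v ∈ F → v < N × v ∉ U) → ∃[ it ] it ∈ pool U O
    go (x ∷ a ∷ b ∷ [] , _ , (x# ∷ a# ∷ _) , fresh) = (x , ns) , ∈-pool⁺ U O in? (proj₁ x-new) valid
      where
      in? : ∀ v → Dec (v ∈ a ∷ b ∷ [])
      in? v = v ∈? (a ∷ b ∷ [])
      ns : List ℕ
      ns = filter in? (upTo N)
      x-new : x < N × x ∉ U
      x-new = fresh (here refl)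
      a-new : a < N × a ∉ U
      a-new = fresh (there (here refl))
      b-new : b < N × b ∉ U
      b-new = fresh (there (there (here refl)))
      ns⁻ : ∀ {v} → v ∈ ns → v ∈ a ∷ b ∷ []
      ns⁻ v∈ = proj₂ (∈-filter⁻ in? {xs = upTo N} v∈)
      ns⁺ : ∀ {v} → v < N → v ∈ a ∷ b ∷ [] → v ∈ ns
      ns⁺ v<N v∈ = ∈-filter⁺ in? (∈-upTo⁺ v<N) v∈
      new : ∀ {v} → v ∈ ns → v ∉ U
      new v∈ = proj₂ (fresh (there (ns⁻ v∈)))
      valid : Valid U O (x , ns)
      valid = proj₂ x-new
            , (λ x∈ → All.lookup x# (ns⁻ x∈) refl)
            , All.tabulate (λ v∈ v∈U → contradiction v∈U (new v∈))
            , ≤-trans (Unique-⊆-length (Unique.filter⁺ in? (Unique.upTo⁺ N)) ns⁻) (m≤m+n 2 (suc n))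
            , fresh₂⁺ (All.lookup a# (here refl))
                (ns⁺ (proj₁ a-new) (here refl)) (proj₂ a-new)
                (ns⁺ (proj₁ b-new) (there (here refl))) (proj₂ b-new)

  pool-min : ∀ h (items : List DataItem) {c} → c ∈ items →
    ∃[ it ] it ∈ items × (∀ {z} → z ∈ items → prec A h z it ≡ false)
  pool-min h (c ∷ cs) _ = pickFirst (prec A h) c cs
    , pickFirst-∈ (prec A h) (prec-irrefl A h) (prec-trans A h) (prec-total A h) c cs
    , pickFirst-min (prec A h) (prec-irrefl A h) (prec-trans A h) (prec-total A h) c cs

  mkPick : ∀ {h U O x ns} → ends h ⊆ U → O ⊆ ends h → (x , ns) ∈ pool U O →
    (∀ {it} → it ∈ pool U O → prec A h it (x , ns) ≡ false) → Pick h U O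
  mkPick {h} {U} {O} {x} {ns} K⊆U O⊆K it∈ it-min = split (ns ∖ (y ∷ U)) refl
    where
    spec : x < N × Ascending ns × (∀ {v} → v ∈ ns → v < N) × Valid U O (x , ns)
    spec = ∈-pool⁻ U O it∈
    valid : Valid U O (x , ns)
    valid = proj₂ (proj₂ (proj₂ spec))
    two : Fresh₂ U ns
    two = proj₂ (proj₂ (proj₂ (proj₂ valid)))
    y : ℕ
    y = choose A h (x , ns)
    y-spec : y ∈ ns × matched h y ≡ false
    y-spec with fresh₂⁻ {U} two
    ... | a , _ , _ , (a∈ , a∉) , _ = greedy A h x ns (lose a∈ (∉⇒unmatched h (a∉ ∘ K⊆U)))
    into : ∀ {v} → v ∈ ns → v ∉ U → v ≢ y → v ∈ ns ∖ (y ∷ U)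
    into v∈ v∉ v≢y = ∈-∖⁺ ns v∈ (λ { (here q) → v≢y q ; (there q) → v∉ q })
    outof : ∀ {v} → v ∈ ns ∖ (y ∷ U) → v ∈ ns × v ∉ U × v ≢ y
    outof v∈ with ∈-∖⁻ ns v∈
    ... | p , q = p , q ∘ there , q ∘ here
    -- Of two distinct fresh neighbours at most one is `y`; the other is the partner that `x` should
    -- have had.
    some : ∃[ v ] v ∈ ns ∖ (y ∷ U)
    some with fresh₂⁻ {U} two
    ... | a , b , a≢b , (a∈ , a∉) , (b∈ , b∉) with a ≟ y
    ...   | no a≢y  = a , into a∈ a∉ a≢y
    ...   | yes a≡y = b , into b∈ b∉ (λ b≡y → a≢b (trans a≡y (sym b≡y)))
    split : ∀ rs → ns ∖ (y ∷ U) ≡ rs → Pick h U O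
    split [] eq with () ← subst (proj₁ some ∈_) eq (proj₂ some)
    split (z ∷ R) eq = record
      { x = x ; ns = ns ; z = z ; R = R
      ; x<N = proj₁ spec ; x∉U = proj₁ valid ; x∉ns = proj₁ (proj₂ valid)
      ; ns<N = proj₁ (proj₂ (proj₂ spec)) ; ns-asc = proj₁ (proj₂ spec)
      ; ns-old = All.lookup (proj₁ (proj₂ (proj₂ valid)))
      ; ns≤Δ = proj₁ (proj₂ (proj₂ (proj₂ valid))) ; fresh₂ = two
      ; y∈ns = proj₁ y-spec
      -- A used neighbour of `x` lies in `O` and is thus already matched, whereas greediness yields
      -- an unmatched one.
      ; y∉U = λ y∈U → unmatched⇒∉ h (proj₂ y-spec)
                (O⊆K (All.lookup (proj₁ (proj₂ (proj₂ valid))) (proj₁ y-spec) y∈U))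
      ; rest⁻ = λ {v} v∈ → outof (subst (v ∈_) (sym eq) v∈)
      ; rest⁺ = λ {v} v∈ v∉ v≢y → subst (v ∈_) eq (into v∈ v∉ v≢y)
      ; rest! = subst Unique eq (∖-unique (ascending-unique (proj₁ (proj₂ spec))))
      ; first = it-min
      }

  pick : ∀ h U O → ends h ⊆ U → O ⊆ ends h → 3 + length U ≤ N → Pick h U O
  pick h U O K⊆U O⊆K room =
    let _ , it∈ , it-min = pool-min h (pool U O) (proj₂ (pool-inhabited U O room))
    in mkPick K⊆U O⊆K it∈ it-min

  -- Here `2 + n` is Δ - 1. The run is bounded from `h` onwards and for every amount of fuel, so the
  -- bound can be pulled back through one round at a time without tracking the fuel.
  Outcome : History → List ℕ → List ℕ → Edges → Set
  Outcome h U O E = ∃[ F ] Extends U O E F × Final F × (∀ f → length (runFrom A (graph N F) f h) ≤ 2 + n)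

  -- What every round has in common

  module Round {r h U O E M} (inv : Invariant r h U O E M) (pk : Pick h U O) where
    open Invariant inv
    open Pick pk

    h′ : History
    h′ = h ++ [ ((x , ns) , y) ]

    length-h′ : length h′ ≡ suc (length h)
    length-h′ = length-∷ʳ h

    O⊆U : O ⊆ U
    O⊆U = K⊆U ∘ O⊆K

    Adj⇒∈U : ∀ {u v} → Adj E u v → u ∈ U
    Adj⇒∈U (_ , inj₁ e) = proj₁ (E⊆U e)
    Adj⇒∈U (_ , inj₂ e) = proj₂ (E⊆U e)

    Adj-cov : ∀ {u v} → Adj E u v → u ∈ ends h ⊎ v ∈ ends h
    Adj-cov (_ , inj₁ e) = E-cov e
    Adj-cov (_ , inj₂ e) = swap (E-cov e)

    rest≢x : ∀ {v} → v ∈ z ∷ R → v ≢ x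
    rest≢x v∈ v≡x = x∉ns (subst (_∈ ns) v≡x (proj₁ (rest⁻ v∈)))

    y∉rest : y ∉ z ∷ R
    y∉rest y∈ = proj₂ (proj₂ (rest⁻ y∈)) refl

    z∈ns : z ∈ ns
    z∈ns = proj₁ (rest⁻ (here refl))

    z∉U : z ∉ U
    z∉U = proj₁ (proj₂ (rest⁻ (here refl)))

    z≢x : z ≢ x
    z≢x = rest≢x (here refl)

    z≢y : z ≢ y
    z≢y = proj₂ (proj₂ (rest⁻ (here refl)))

    K⊆K′ : ends h ⊆ ends h′
    K⊆K′ v∈ = subst (_ ∈_) (sym (ends-∷ʳ h x ns y)) (∈-++⁺ˡ v∈)

    x∈K′ : x ∈ ends h′
    x∈K′ = subst (x ∈_) (sym (ends-∷ʳ h x ns y)) (∈-++⁺ʳ (ends h) (here refl))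

    y∈K′ : y ∈ ends h′
    y∈K′ = subst (y ∈_) (sym (ends-∷ʳ h x ns y)) (∈-++⁺ʳ (ends h) (there (here refl)))

    M∌ : ∀ {v} → v ∉ U → All (v ≢_) (endpoints M)
    M∌ v∉U = All.tabulate (λ w∈ v≡w → v∉U (subst (_∈ U) (sym v≡w) (proj₁ (M⊆U w∈))))

    O∌ : ∀ {v} → v ∉ U → v ∉ O
    O∌ v∉U = v∉U ∘ O⊆U

    -- Every available item of a completion lies in the pool, so A receives the pool's first item.
    fires : ∀ {F} → Extends U O E F → Final F → star x ns ⊆ F → (∀ {v} → Adj F x v → v ∈ ns) →
      ∀ f → runFrom A (graph N F) (suc f) h ≡ runFrom A (graph N F) f h′
    fires {F} ext fin star⊆F x-nbrs f = runFrom-pick A G f h it∈ it-min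
      where
      open Extends ext
      open Final fin
      G : Graph
      G = graph N F
      x-adj : ∀ {v} → v ∈ ns → Adj F x v
      x-adj v∈ = (λ { refl → x∉ns v∈ }) , inj₁ (star⊆F (∈-star⁺ v∈))
      it∈ : (x , ns) ∈ map (dataItem G) (available G h)
      it∈ = subst (_∈ map (dataItem G) (available G h))
        (dataItem-≡ N F ns-asc (λ v∈ → ns<N v∈ , x-adj v∈) x-nbrs)
        (∈-map⁺ (dataItem G) (∈-available⁺ G h (∈-upTo⁺ x<N) (x∉U ∘ K⊆U)
          (∈-nbrs⁺ N F (ns<N y∈ns) (x-adj y∈ns)) (y∉U ∘ K⊆U)))
      valid : ∀ {u v} → u ∉ ends h → v ∉ ends h → Adj F u v → Valid U O (dataItem G u)
      valid {u} {v} u∉K v∉K uv = u∉U , (λ u∈ → proj₁ (proj₂ (∈-nbrs⁻ N F u∈)) refl)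
        , All.tabulate old-nbr
        , ≤-trans (degree-≤ N F u (proj₁ (proj₂ (degrees u)))) (proj₂ (proj₂ (degrees u)))
        , two (spread u∉U uv)
        where
        -- An edge at a used node is either old, and then has a matched end, or starts in `O`, whose
        -- nodes are matched. So no used node is still available.
        u∉U : u ∉ U
        u∉U u∈U with closed u∈U uv
        ... | inj₁ a         = [ u∉K , v∉K ]′ (Adj-cov a)
        ... | inj₂ (u∈O , _) = u∉K (O⊆K u∈O)
        old-nbr : ∀ {w} → w ∈ nbrs G u → w ∈ U → w ∈ O
        old-nbr w∈ w∈U with closed w∈U (Adj-sym (proj₂ (∈-nbrs⁻ N F w∈)))
        ... | inj₁ a         = contradiction (Adj⇒∈U (Adj-sym a)) u∉U
        ... | inj₂ (w∈O , _) = w∈O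
        two : _ → Fresh₂ U (nbrs G u)
        two (a , b , a≢b , (a∉ , a<N , ua) , (b∉ , b<N , ub)) =
          fresh₂⁺ a≢b (∈-nbrs⁺ N F a<N ua) a∉ (∈-nbrs⁺ N F b<N ub) b∉
      it-min : ∀ {it} → it ∈ map (dataItem G) (available G h) → prec A h it (x , ns) ≡ false
      it-min it∈ with ∈-map⁻ (dataItem G) it∈
      ... | u , u∈ , refl with ∈-available⁻ G h u∈
      ...   | u∈V , u∉K , v , v∈ , v∉K = first
                (∈-pool⁺ U O (T? ∘ adj G u) (∈-upTo⁻ u∈V) (valid u∉K v∉K (proj₂ (∈-nbrs⁻ N F v∈))))

    run-bound : ∀ {F} → Extends U O E F → Final F → star x ns ⊆ F → (∀ {v} → Adj F x v → v ∈ ns) →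
      (∀ f → length (runFrom A (graph N F) f h′) ≤ 2 + n) →
      ∀ f → length (runFrom A (graph N F) f h) ≤ 2 + n
    run-bound ext fin star⊆F x-nbrs bound zero =
      ≤-trans (≤-trans (m≤m+n (length h) r) (≤-reflexive rounds)) (m≤n+m n 2)
    run-bound ext fin star⊆F x-nbrs bound (suc f) =
      subst (λ k → length k ≤ 2 + n) (sym (fires ext fin star⊆F x-nbrs f)) (bound f)

  -- The rounds before the last one

  module Mistake {r h U O E M} (inv : Invariant (suc r) h U O E M) (pk : Pick h U O) where
    open Invariant inv
    open Pick pk
    open Round inv pk

    E′ : Edges
    E′ = star x ns ++ star y (z ∷ R) ++ E

    data Step (u v : ℕ) : Set where
      x-out : u ≡ x → v ∈ ns → Step u v
      x-in  : v ≡ x → u ∈ ns → Step u v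
      y-out : u ≡ y → v ∈ z ∷ R → Step u v
      y-in  : v ≡ y → u ∈ z ∷ R → Step u v
      past  : Adj E u v → Step u v

    step : ∀ {u v} → Adj E′ u v → Step u v
    step a with Adj-++⁻ (star x ns) a
    ... | inj₁ b = [ (λ (p , q) → x-out p q) , (λ (p , q) → x-in p q) ]′ (Adj-star⁻ b)
    ... | inj₂ b with Adj-++⁻ (star y (z ∷ R)) b
    ...   | inj₁ c = [ (λ (p , q) → y-out p q) , (λ (p , q) → y-in p q) ]′ (Adj-star⁻ c)
    ...   | inj₂ c = past c

    data StepEdge (a b : ℕ) : Set where
      from-x : a ≡ x → b ∈ ns → StepEdge a b
      from-y : a ≡ y → b ∈ z ∷ R → StepEdge a b
      past   : (a , b) ∈ E → StepEdge a b

    step-edge : ∀ {a b} → (a , b) ∈ E′ → StepEdge a b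
    step-edge e with ∈-++⁻ (star x ns) e
    ... | inj₁ p = let q , s = ∈-star⁻ p in from-x q s
    ... | inj₂ p with ∈-++⁻ (star y (z ∷ R)) p
    ...   | inj₁ q = let s , t = ∈-star⁻ q in from-y s t
    ...   | inj₂ q = past q

    xE′ : star x ns ⊆ E′
    xE′ = ∈-++⁺ˡ

    yE′ : star y (z ∷ R) ⊆ E′
    yE′ = ∈-++⁺ʳ (star x ns) ∘ ∈-++⁺ˡ

    E⊆E′ : E ⊆ E′
    E⊆E′ = ∈-++⁺ʳ (star x ns) ∘ ∈-++⁺ʳ (star y (z ∷ R))

    x-nbrs′ : ∀ {v} → Adj E′ x v → v ∈ ns
    x-nbrs′ a with step a
    ... | x-out _ v∈  = v∈
    ... | x-in _ x∈   = contradiction x∈ x∉ns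
    ... | y-out x≡y _ = contradiction x≡y x≢y
    ... | y-in _ x∈   = contradiction refl (rest≢x x∈)
    ... | past b      = contradiction (Adj⇒∈U b) x∉U

    -- Shared by both kinds of round, which differ only in whether `y` enters `O` and in which edges
    -- enter `M`. In `y-deg`, `2 + length R` is the number of neighbours of `y` so far.
    module Next (O′ : List ℕ) (M′ : Edges)
                (O′⁻ : ∀ {o} → o ∈ O′ → o ≡ y ⊎ o ∈ O) (O⊆O′ : O ⊆ O′) (O′! : Unique O′)
                (y-deg : y ∈ O′ → 2 + length R + (2 + r) ≤ Δ)
                (M′! : Unique (endpoints M′))
                (M′⊆U : ∀ {v} → v ∈ endpoints M′ → v ∈ U′ × v ∉ O′)
                (M′⊆E : ∀ {a b} → (a , b) ∈ M′ → (a , b) ∈ E′ × a ≢ b)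
                (M′-size : length M′ + length O′ ≡ 2 * suc (length h))
                (O′-size : length O′ ≤ suc (length h)) where

      x∉O′ : x ∉ O′
      x∉O′ x∈ = [ x≢y , x∉U ∘ O⊆U ]′ (O′⁻ x∈)

      deg′ : ∀ {u} → u ∈ U′ → ∃[ L ] (∀ {v} → Adj E′ u v → v ∈ L)
               × length L ≤ Δ × (u ∈ O′ → length L + (2 + r) ≤ Δ)
      deg′ u∈ with region u∈
      ... | at-x = ns , x-nbrs′ , ns≤Δ , λ x∈ → contradiction x∈ x∉O′
      ... | at-y = x ∷ z ∷ R , cover ∘ step , ≤-trans rest≤ns ns≤Δ , y-deg
        where
        cover : ∀ {v} → Step y v → v ∈ x ∷ z ∷ R
        cover (x-out y≡x _) = contradiction (sym y≡x) x≢y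
        cover (x-in refl _) = here refl
        cover (y-out _ v∈)  = there v∈
        cover (y-in _ y∈)   = contradiction y∈ y∉rest
        cover (past b)      = contradiction (Adj⇒∈U b) y∉U
      ... | rest {u} u∈R = x ∷ y ∷ [] , cover ∘ step , m≤m+n 2 (suc n)
                         , λ u∈O′ → ⊥-elim ([ proj₂ (proj₂ (rest⁻ u∈R)) , u∉U ∘ O⊆U ]′ (O′⁻ u∈O′))
        where
        u∉U : u ∉ U
        u∉U = proj₁ (proj₂ (rest⁻ u∈R))
        cover : ∀ {v} → Step u v → v ∈ x ∷ y ∷ []
        cover (x-out u≡x _) = contradiction u≡x (rest≢x u∈R)
        cover (x-in refl _) = here refl
        cover (y-out u≡y _) = contradiction u≡y (proj₂ (proj₂ (rest⁻ u∈R)))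
        cover (y-in refl _) = there (here refl)
        cover (past b)      = contradiction (Adj⇒∈U b) u∉U
      ... | old {u} u∈U with deg u∈U | u ∈? O
      -- The new `x` may be adjacent to any node of `O`, so each of them pays one unit of its spare
      -- per round.
      ...   | L , cover , _ , spare | yes u∈O =
                x ∷ L , cover′ ∘ step , ≤-trans (m≤m+n _ _) room , λ _ → room
        where
        room : suc (length L) + (2 + r) ≤ Δ
        room = subst (_≤ Δ) (+-suc (length L) (2 + r)) (spare u∈O)
        cover′ : ∀ {v} → Step u v → v ∈ x ∷ L
        cover′ (x-out refl _) = contradiction u∈U x∉U
        cover′ (x-in refl _)  = here refl
        cover′ (y-out u≡y _)  = contradiction (subst (_∈ U) u≡y u∈U) y∉U
        cover′ (y-in _ u∈R)   = contradiction u∈U (proj₁ (proj₂ (rest⁻ u∈R)))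
        cover′ (past b)       = there (cover b)
      ...   | L , cover , L≤Δ , _ | no u∉O =
                L , cover′ ∘ step , L≤Δ , λ u∈O′ → ⊥-elim ([ u≢y , u∉O ]′ (O′⁻ u∈O′))
        where
        u≢y : u ≢ y
        u≢y u≡y = y∉U (subst (_∈ U) u≡y u∈U)
        cover′ : ∀ {v} → Step u v → v ∈ L
        cover′ (x-out refl _) = contradiction u∈U x∉U
        cover′ (x-in _ u∈ns)  = contradiction (ns-old u∈ns u∈U) u∉O
        cover′ (y-out u≡y _)  = contradiction u≡y u≢y
        cover′ (y-in _ u∈R)   = contradiction u∈U (proj₁ (proj₂ (rest⁻ u∈R)))
        cover′ (past b)       = cover b

      invariant : Invariant r h′ U′ O′ E′ M′
      invariant = record
        { U<N    = U′<N U<N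
        ; K⊆U    = K′⊆U′
        ; O⊆K    = λ o∈ → [ (λ o≡y → subst (_∈ ends h′) (sym o≡y) y∈K′) , K⊆K′ ∘ O⊆K ]′ (O′⁻ o∈)
        ; O!     = O′!
        ; E⊆U    = E′⊆U′ ∘ step-edge
        ; E-cov  = E′-cov ∘ step-edge
        ; deg    = deg′
        ; M!     = M′!
        ; M⊆U    = M′⊆U
        ; M⊆E    = M′⊆E
        ; M-size = trans M′-size (cong (2 *_) (sym length-h′))
        ; O-size = ≤-trans O′-size (≤-reflexive (sym length-h′))
        ; rounds = trans (cong (_+ r) length-h′) (trans (sym (+-suc (length h) r)) rounds)
        ; budget = budget′
        }
        where
        K′⊆U′ : ends h′ ⊆ U′
        K′⊆U′ v∈ with ∈-++⁻ (ends h) (subst (_ ∈_) (ends-∷ʳ h x ns y) v∈)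
        ... | inj₁ v∈K              = U⊆U′ (K⊆U v∈K)
        ... | inj₂ (here v≡x)       = here v≡x
        ... | inj₂ (there (here v≡y)) = ns⊆U′ (subst (_∈ ns) (sym v≡y) y∈ns)
        E′⊆U′ : ∀ {a b} → StepEdge a b → a ∈ U′ × b ∈ U′
        E′⊆U′ (from-x refl b∈) = here refl , ns⊆U′ b∈
        E′⊆U′ (from-y a≡y b∈)  = ns⊆U′ (subst (_∈ ns) (sym a≡y) y∈ns) , ns⊆U′ (proj₁ (rest⁻ b∈))
        E′⊆U′ (past e)         = U⊆U′ (proj₁ (E⊆U e)) , U⊆U′ (proj₂ (E⊆U e))
        E′-cov : ∀ {a b} → StepEdge a b → a ∈ ends h′ ⊎ b ∈ ends h′
        E′-cov (from-x refl _) = inj₁ x∈K′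
        E′-cov (from-y a≡y _)  = inj₁ (subst (_∈ ends h′) (sym a≡y) y∈K′)
        E′-cov (past e)        = [ inj₁ ∘ K⊆K′ , inj₂ ∘ K⊆K′ ]′ (E-cov e)
        budget′ : length U′ + (suc r * suc Δ + Δ) ≤ N
        budget′ = begin
          suc (length (ns ++ U)) + rem        ≡⟨ cong (λ k → suc k + rem) (length-++ ns) ⟩
          suc (length ns + length U) + rem    ≤⟨ +-monoˡ-≤ rem (s≤s (+-monoˡ-≤ (length U) ns≤Δ)) ⟩
          suc (Δ + length U) + rem            ≡⟨ cong (_+ rem) (+-comm (suc Δ) (length U)) ⟩
          length U + suc Δ + rem              ≡⟨ +-assoc (length U) (suc Δ) rem ⟩
          length U + (suc Δ + rem)            ≡⟨ cong (length U +_) (sym (+-assoc (suc Δ) (suc r * suc Δ) Δ)) ⟩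
          length U + (suc (suc r) * suc Δ + Δ) ≤⟨ budget ⟩
          N                                   ∎
          where
          open ≤-Reasoning
          rem : ℕ
          rem = suc r * suc Δ + Δ

      extends : ∀ {F} → Extends U′ O′ E′ F → Extends U O E F
      extends {F} ext = record { E⊆F = E′⊆F ∘ E⊆E′ ; closed = closed′ ; spread = spread′ }
        where
        open Extends ext renaming (E⊆F to E′⊆F)
        closed′ : ∀ {u v} → u ∈ U → Adj F u v → Adj E u v ⊎ (u ∈ O × v ∉ U)
        closed′ {u} u∈U uv with closed (U⊆U′ u∈U) uv
        ... | inj₂ (u∈O′ , v∉U′) with O′⁻ u∈O′
        ...   | inj₁ u≡y = contradiction (subst (_∈ U) u≡y u∈U) y∉U
        ...   | inj₂ u∈O = inj₂ (u∈O , v∉U′ ∘ U⊆U′)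
        closed′ {u} u∈U uv | inj₁ a with step a
        ...   | x-out refl _    = contradiction u∈U x∉U
        ...   | x-in refl u∈ns  = inj₂ (ns-old u∈ns u∈U , x∉U)
        ...   | y-out u≡y _     = contradiction (subst (_∈ U) u≡y u∈U) y∉U
        ...   | y-in _ u∈R      = contradiction u∈U (proj₁ (proj₂ (rest⁻ u∈R)))
        ...   | past b          = inj₁ b
        x-adj : ∀ {v} → v ∈ ns → Adj F x v
        x-adj v∈ = (λ { refl → x∉ns v∈ }) , inj₁ (E′⊆F (xE′ (∈-star⁺ v∈)))
        y-adj : ∀ {v} → v ∈ z ∷ R → Adj F y v
        y-adj v∈ = proj₂ (proj₂ (rest⁻ v∈)) ∘ sym , inj₁ (E′⊆F (yE′ (∈-star⁺ v∈)))
        spread′ : ∀ {u v} → u ∉ U → Adj F u v →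
          ∃[ a ] ∃[ b ] a ≢ b × (a ∉ U × a < N × Adj F u a) × (b ∉ U × b < N × Adj F u b)
        spread′ {u} u∉U uv with u ∈? U′
        ... | no u∉U′ with spread u∉U′ uv
        ...   | a , b , a≢b , (a∉ , ua) , (b∉ , ub) = a , b , a≢b , (a∉ ∘ U⊆U′ , ua) , (b∉ ∘ U⊆U′ , ub)
        spread′ {u} u∉U uv | yes u∈U′ with region u∈U′
        ...   | old u∈U = contradiction u∈U u∉U
        -- A sacrificed node needs two fresh neighbours for its own item to lie in the pool; joining
        -- it to `y` as well as to `x` supplies them.
        ...   | rest u∈R = x , y , x≢y
                         , (x∉U , x<N , Adj-sym (x-adj (proj₁ (rest⁻ u∈R))))
                         , (y∉U , ns<N y∈ns , Adj-sym (y-adj u∈R))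
        ...   | at-y = x , z , z≢x ∘ sym
                     , (x∉U , x<N , Adj-sym (x-adj y∈ns))
                     , (z∉U , ns<N z∈ns , y-adj (here refl))
        ...   | at-x with fresh₂⁻ {U} fresh₂
        ...     | a , b , a≢b , (a∈ , a∉) , (b∈ , b∉) =
                  a , b , a≢b , (a∉ , ns<N a∈ , x-adj a∈) , (b∉ , ns<N b∈ , x-adj b∈)

      outcome : Outcome h′ U′ O′ E′ → Outcome h U O E
      outcome (F , ext , fin , bound) =
        F , extends ext , fin , run-bound (extends ext) fin (E⊆F ∘ xE′) x-nbrs bound
        where
        open Extends ext
        x-nbrs : ∀ {v} → Adj F x v → v ∈ ns
        x-nbrs a with closed (here refl) a
        ... | inj₁ b         = x-nbrs′ b
        ... | inj₂ (x∈O′ , _) = contradiction x∈O′ x∉O′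

    xz∈E′ : (x , z) ∈ E′
    xz∈E′ = xE′ (∈-star⁺ z∈ns)

    -- The fresh part of the round is the triangle on `x`, `y`, `z`, which holds only one edge of a
    -- matching. That edge is `(x , z)`; `y` enters `O` and stands for the second edge owed.
    triangle : R ≡ [] → (∀ {h U O E M} → Invariant r h U O E M → Outcome h U O E) → Outcome h U O E
    triangle R≡[] continue = outcome (continue invariant)
      where
      -- Two neighbours plus a reserve of `2 + r` make `4 + r`, at most Δ = `3 + n` because
      -- `length h + suc r` equals `n`.
      y-deg : y ∈ y ∷ O → 2 + length R + (2 + r) ≤ Δ
      y-deg _ = subst (λ k → 2 + length k + (2 + r) ≤ Δ) (sym R≡[])
        (s≤s (s≤s (s≤s (≤-trans (m≤n+m (suc r) (length h)) (≤-reflexive rounds)))))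
      size : suc (length M) + suc (length O) ≡ 2 * suc (length h)
      size = trans (cong suc (+-suc (length M) (length O)))
        (trans (cong (2 +_) M-size) (sym (*-suc 2 (length h))))
      in-U : ∀ {v} → v ∈ x ∷ z ∷ endpoints M → v ∈ U′ × v ∉ y ∷ O
      in-U (here refl) = here refl , λ { (here p) → x≢y p ; (there p) → O∌ x∉U p }
      in-U (there (here refl)) = ns⊆U′ z∈ns , λ { (here p) → z≢y p ; (there p) → O∌ z∉U p }
      in-U (there (there v∈)) = U⊆U′ (proj₁ (M⊆U v∈))
        , λ { (here p) → y∉U (subst (_∈ U) p (proj₁ (M⊆U v∈))) ; (there p) → proj₂ (M⊆U v∈) p }
      in-E : ∀ {a b} → (a , b) ∈ (x , z) ∷ M → (a , b) ∈ E′ × a ≢ b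
      in-E (here refl) = xz∈E′ , z≢x ∘ sym
      in-E (there e)   = E⊆E′ (proj₁ (M⊆E e)) , proj₂ (M⊆E e)
      O′⁻ : ∀ {o} → o ∈ y ∷ O → o ≡ y ⊎ o ∈ O
      O′⁻ (here p)  = inj₁ p
      O′⁻ (there p) = inj₂ p
      O′! : Unique (y ∷ O)
      O′! = All.tabulate (λ o∈ y≡o → y∉U (subst (_∈ U) (sym y≡o) (O⊆U o∈))) ∷ O!
      open Next (y ∷ O) ((x , z) ∷ M)
        O′⁻ there O′!
        y-deg ((z≢x ∘ sym ∷ M∌ x∉U) ∷ M∌ z∉U ∷ M!) in-U in-E size (s≤s O-size)

    -- A second common neighbour `w` of `x` and `y` allows both owed edges, `(x , z)` and `(y , w)`,
    -- to be placed at once, so `O` stays as it is. Any further nodes of `R` remain outside `M`.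
    book : ∀ {w R′} → R ≡ w ∷ R′ →
      (∀ {h U O E M} → Invariant r h U O E M → Outcome h U O E) → Outcome h U O E
    book {w} R≡ continue = outcome (continue invariant)
      where
      w∈R : w ∈ R
      w∈R = subst (w ∈_) (sym R≡) (here refl)
      w-spec : w ∈ ns × w ∉ U × w ≢ y
      w-spec = rest⁻ (there w∈R)
      w∉U : w ∉ U
      w∉U = proj₁ (proj₂ w-spec)
      w≢x : w ≢ x
      w≢x = rest≢x (there w∈R)
      w≢y : w ≢ y
      w≢y = proj₂ (proj₂ w-spec)
      z≢w : z ≢ w
      z≢w = All.lookup (AllPairs.head rest!) w∈R
      size : suc (suc (length M)) + length O ≡ 2 * suc (length h)
      size = trans (cong (2 +_) M-size) (sym (*-suc 2 (length h)))
      in-U : ∀ {v} → v ∈ x ∷ z ∷ y ∷ w ∷ endpoints M → v ∈ U′ × v ∉ O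
      in-U (here refl) = here refl , O∌ x∉U
      in-U (there (here refl)) = ns⊆U′ z∈ns , O∌ z∉U
      in-U (there (there (here p))) = subst (λ v → v ∈ U′ × v ∉ O) (sym p) (ns⊆U′ y∈ns , O∌ y∉U)
      in-U (there (there (there (here refl)))) = ns⊆U′ (proj₁ w-spec) , O∌ w∉U
      in-U (there (there (there (there v∈)))) = U⊆U′ (proj₁ (M⊆U v∈)) , proj₂ (M⊆U v∈)
      in-E : ∀ {a b} → (a , b) ∈ (x , z) ∷ (y , w) ∷ M → (a , b) ∈ E′ × a ≢ b
      in-E (here refl) = xz∈E′ , z≢x ∘ sym
      in-E (there (here p)) = subst (λ (a , b) → (a , b) ∈ E′ × a ≢ b) (sym p)
        (yE′ (∈-star⁺ (there w∈R)) , w≢y ∘ sym)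
      in-E (there (there e)) = E⊆E′ (proj₁ (M⊆E e)) , proj₂ (M⊆E e)
      M′! : Unique (endpoints ((x , z) ∷ (y , w) ∷ M))
      M′! = (z≢x ∘ sym ∷ x≢y ∷ w≢x ∘ sym ∷ M∌ x∉U) ∷ (z≢y ∷ z≢w ∷ M∌ z∉U)
              ∷ (w≢y ∘ sym ∷ M∌ y∉U) ∷ M∌ w∉U ∷ M!
      open Next O ((x , z) ∷ (y , w) ∷ M) inj₂ id O!
        (λ y∈O → contradiction (O⊆U y∈O) y∉U) M′! in-U in-E size (m≤n⇒m≤1+n O-size)

    advance : (∀ {h U O E M} → Invariant r h U O E M → Outcome h U O E) → Outcome h U O E
    advance continue = go R refl
      where
      go : ∀ rs → R ≡ rs → Outcome h U O E
      go []      eq = triangle eq continue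
      go (_ ∷ _) eq = book eq continue

  -- The last round with two hubs

  module Endgame {h U O E M} (inv : Invariant 0 h U O E M) (pk : Pick h U O) where
    open Invariant inv
    open Pick pk
    open Round inv pk

    |h|≡n : length h ≡ n
    |h|≡n = trans (sym (+-identityʳ (length h))) rounds

    -- The partners in the matching are q₀ for y, q₁ for c, and Q″ for O.
    module Finish (c q₀ q₁ : ℕ) (Q″ : List ℕ)
                  (c<N : c < N) (c∉U′ : c ∉ U′)
                  (|Q″| : length Q″ ≡ n) (Q! : Unique (q₀ ∷ q₁ ∷ Q″)) (R⊆Q : R ⊆ q₀ ∷ q₁ ∷ Q″)
                  (Q-spec : ∀ {v} → v ∈ q₀ ∷ q₁ ∷ Q″ → (v < N × v ∉ U) × v ≢ x × v ≢ y × v ≢ z × v ≢ c) where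

      Q : List ℕ
      Q = q₀ ∷ q₁ ∷ Q″

      F : Edges
      -- The node `z` hangs on `c` instead of `y`. The neighbours of `y` are `x` and the Δ - 1 nodes
      -- of `Q`, those of `c` are `z` and `Q`, so both have degree Δ; and `z` keeps two fresh
      -- neighbours, `x` and `c`.
      F = star x ns ++ star y Q ++ star c (z ∷ Q) ++ zip O Q″ ++ E

      data Link (u v : ℕ) : Set where
        x-out    : u ≡ x → v ∈ ns → Link u v
        x-in     : v ≡ x → u ∈ ns → Link u v
        y-out    : u ≡ y → v ∈ Q → Link u v
        y-in     : v ≡ y → u ∈ Q → Link u v
        c-out    : u ≡ c → v ∈ z ∷ Q → Link u v
        c-in     : v ≡ c → u ∈ z ∷ Q → Link u v
        zip-out  : (u , v) ∈ zip O Q″ → Link u v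
        zip-in   : (v , u) ∈ zip O Q″ → Link u v
        past     : Adj E u v → Link u v

      link : ∀ {u v} → Adj F u v → Link u v
      link a with Adj-++⁻ (star x ns) a
      ... | inj₁ b = [ (λ (p , q) → x-out p q) , (λ (p , q) → x-in p q) ]′ (Adj-star⁻ b)
      ... | inj₂ a₁ with Adj-++⁻ (star y Q) a₁
      ...   | inj₁ b = [ (λ (p , q) → y-out p q) , (λ (p , q) → y-in p q) ]′ (Adj-star⁻ b)
      ...   | inj₂ a₂ with Adj-++⁻ (star c (z ∷ Q)) a₂
      ...     | inj₁ b = [ (λ (p , q) → c-out p q) , (λ (p , q) → c-in p q) ]′ (Adj-star⁻ b)
      ...     | inj₂ a₃ with Adj-++⁻ (zip O Q″) a₃
      ...       | inj₁ (_ , b) = [ zip-out , zip-in ]′ b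
      ...       | inj₂ b = past b

      xF : star x ns ⊆ F
      xF = ∈-++⁺ˡ

      yF : star y Q ⊆ F
      yF = ∈-++⁺ʳ (star x ns) ∘ ∈-++⁺ˡ

      cF : star c (z ∷ Q) ⊆ F
      cF = ∈-++⁺ʳ (star x ns) ∘ ∈-++⁺ʳ (star y Q) ∘ ∈-++⁺ˡ

      zipF : zip O Q″ ⊆ F
      zipF = ∈-++⁺ʳ (star x ns) ∘ ∈-++⁺ʳ (star y Q) ∘ ∈-++⁺ʳ (star c (z ∷ Q)) ∘ ∈-++⁺ˡ

      E⊆F : E ⊆ F
      E⊆F = ∈-++⁺ʳ (star x ns) ∘ ∈-++⁺ʳ (star y Q) ∘ ∈-++⁺ʳ (star c (z ∷ Q)) ∘ ∈-++⁺ʳ (zip O Q″)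

      c∉U : c ∉ U
      c∉U = c∉U′ ∘ U⊆U′

      c∉ns : c ∉ ns
      c∉ns = c∉U′ ∘ ns⊆U′

      c≢x : c ≢ x
      c≢x c≡x = c∉U′ (here c≡x)

      c≢y : c ≢ y
      c≢y c≡y = c∉ns (subst (_∈ ns) (sym c≡y) y∈ns)

      c≢z : c ≢ z
      c≢z c≡z = c∉ns (subst (_∈ ns) (sym c≡z) z∈ns)

      Q<N : ∀ {v} → v ∈ Q → v < N
      Q<N = proj₁ ∘ proj₁ ∘ Q-spec

      Q∌U : ∀ {v} → v ∈ Q → v ∉ U
      Q∌U = proj₂ ∘ proj₁ ∘ Q-spec

      Q≢x : ∀ {v} → v ∈ Q → v ≢ x
      Q≢x = proj₁ ∘ proj₂ ∘ Q-spec

      Q≢y : ∀ {v} → v ∈ Q → v ≢ y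
      Q≢y = proj₁ ∘ proj₂ ∘ proj₂ ∘ Q-spec

      Q≢z : ∀ {v} → v ∈ Q → v ≢ z
      Q≢z = proj₁ ∘ proj₂ ∘ proj₂ ∘ proj₂ ∘ Q-spec

      Q≢c : ∀ {v} → v ∈ Q → v ≢ c
      Q≢c = proj₂ ∘ proj₂ ∘ proj₂ ∘ proj₂ ∘ Q-spec

      zQ∌U : ∀ {v} → v ∈ z ∷ Q → v ∉ U
      zQ∌U (here refl) = z∉U
      zQ∌U (there v∈)  = Q∌U v∈

      zQ≢x : ∀ {v} → v ∈ z ∷ Q → v ≢ x
      zQ≢x (here refl) = z≢x
      zQ≢x (there v∈)  = Q≢x v∈

      zQ≢y : ∀ {v} → v ∈ z ∷ Q → v ≢ y
      zQ≢y (here refl) = z≢y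
      zQ≢y (there v∈)  = Q≢y v∈

      zQ≢c : ∀ {v} → v ∈ z ∷ Q → v ≢ c
      zQ≢c (here refl) = c≢z ∘ sym
      zQ≢c (there v∈)  = Q≢c v∈

      zip⁻ : ∀ {a b} → (a , b) ∈ zip O Q″ → a ∈ O × b ∈ Q
      zip⁻ p = let q , r = ∈-zip⁻ O Q″ p in q , there (there r)

      x-adj : ∀ {v} → v ∈ ns → Adj F x v
      x-adj v∈ = (λ { refl → x∉ns v∈ }) , inj₁ (xF (∈-star⁺ v∈))

      y-adj : ∀ {v} → v ∈ Q → Adj F y v
      y-adj v∈ = Q≢y v∈ ∘ sym , inj₁ (yF (∈-star⁺ v∈))

      c-adj : ∀ {v} → v ∈ z ∷ Q → Adj F c v
      c-adj v∈ = zQ≢c v∈ ∘ sym , inj₁ (cF (∈-star⁺ v∈))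

      x-nbrs : ∀ {v} → Link x v → v ∈ ns
      x-nbrs (x-out _ v∈)  = v∈
      x-nbrs (x-in _ x∈)   = contradiction x∈ x∉ns
      x-nbrs (y-out x≡y _) = contradiction x≡y x≢y
      x-nbrs (y-in _ x∈)   = contradiction refl (Q≢x x∈)
      x-nbrs (c-out x≡c _) = contradiction (sym x≡c) c≢x
      x-nbrs (c-in _ x∈)   = contradiction refl (zQ≢x x∈)
      x-nbrs (zip-out p)   = contradiction (O⊆U (proj₁ (zip⁻ p))) x∉U
      x-nbrs (zip-in p)    = contradiction refl (Q≢x (proj₂ (zip⁻ p)))
      x-nbrs (past b)      = contradiction (Adj⇒∈U b) x∉U

      U-nbrs : ∀ {u v} → u ∈ U → Link u v →
        Adj E u v ⊎ (u ∈ O × (v ≡ x ⊎ (u , v) ∈ zip O Q″))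
      U-nbrs u∈U (x-out refl _)   = contradiction u∈U x∉U
      U-nbrs u∈U (x-in v≡x u∈ns)  = inj₂ (ns-old u∈ns u∈U , inj₁ v≡x)
      U-nbrs u∈U (y-out u≡y _)    = contradiction (subst (_∈ U) u≡y u∈U) y∉U
      U-nbrs u∈U (y-in _ u∈Q)     = contradiction u∈U (Q∌U u∈Q)
      U-nbrs u∈U (c-out refl _)   = contradiction u∈U c∉U
      U-nbrs u∈U (c-in _ u∈zQ)    = contradiction u∈U (zQ∌U u∈zQ)
      U-nbrs u∈U (zip-out p)      = inj₂ (proj₁ (zip⁻ p) , inj₂ p)
      U-nbrs u∈U (zip-in p)       = contradiction u∈U (Q∌U (proj₂ (zip⁻ p)))
      U-nbrs u∈U (past b)         = inj₁ b

      data Place (u : ℕ) : Set where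
        at-x  : u ≡ x → Place u
        at-y  : u ≡ y → Place u
        at-z  : u ≡ z → Place u
        at-c  : u ≡ c → Place u
        in-Q  : u ∈ Q → Place u
        old   : u ∈ U → Place u

      place : ∀ {u v} → Link u v → Place u
      place (x-out u≡x _)        = at-x u≡x
      place {u} (x-in _ u∈ns) with u ∈? U | u ≟ y
      ... | yes u∈U | _       = old u∈U
      ... | no _    | yes u≡y = at-y u≡y
      ... | no u∉U  | no u≢y with rest⁺ u∈ns u∉U u≢y
      ...   | here u≡z  = at-z u≡z
      ...   | there u∈R = in-Q (R⊆Q u∈R)
      place (y-out u≡y _)        = at-y u≡y
      place (y-in _ u∈Q)         = in-Q u∈Q
      place (c-out u≡c _)        = at-c u≡c
      place (c-in _ (here u≡z))  = at-z u≡z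
      place (c-in _ (there u∈Q)) = in-Q u∈Q
      place (zip-out p)          = old (O⊆U (proj₁ (zip⁻ p)))
      place (zip-in p)           = in-Q (proj₂ (zip⁻ p))
      place (past b)             = old (Adj⇒∈U b)

      extends : Extends U O E F
      extends = record
        { E⊆F    = E⊆F
        ; closed = λ u∈U uv → closed u∈U (U-nbrs u∈U (link uv))
        ; spread = λ u∉U uv → spread u∉U (place (link uv))
        }
        where
        closed : ∀ {u v} → u ∈ U → Adj E u v ⊎ (u ∈ O × (v ≡ x ⊎ (u , v) ∈ zip O Q″)) →
          Adj E u v ⊎ (u ∈ O × v ∉ U)
        closed _ (inj₁ b)                 = inj₁ b
        closed _ (inj₂ (u∈O , inj₁ refl)) = inj₂ (u∈O , x∉U)
        closed _ (inj₂ (u∈O , inj₂ p))    = inj₂ (u∈O , Q∌U (proj₂ (zip⁻ p)))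
        q₀∈ : q₀ ∈ Q
        q₀∈ = here refl
        q₁∈ : q₁ ∈ Q
        q₁∈ = there (here refl)
        spread : ∀ {u} → u ∉ U → Place u →
          ∃[ a ] ∃[ b ] a ≢ b × (a ∉ U × a < N × Adj F u a) × (b ∉ U × b < N × Adj F u b)
        spread _ (at-x refl) with fresh₂⁻ {U} fresh₂
        ... | a , b , a≢b , (a∈ , a∉) , (b∈ , b∉) =
              a , b , a≢b , (a∉ , ns<N a∈ , x-adj a∈) , (b∉ , ns<N b∈ , x-adj b∈)
        spread _ (at-y u≡y) = subst
          (λ u → ∃[ a ] ∃[ b ] a ≢ b × (a ∉ U × a < N × Adj F u a) × (b ∉ U × b < N × Adj F u b)) (sym u≡y)
          (x , q₀ , Q≢x q₀∈ ∘ sym , (x∉U , x<N , Adj-sym (x-adj y∈ns)) , (Q∌U q₀∈ , Q<N q₀∈ , y-adj q₀∈))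
        spread _ (at-z refl) = x , c , c≢x ∘ sym
          , (x∉U , x<N , Adj-sym (x-adj z∈ns)) , (c∉U , c<N , Adj-sym (c-adj (here refl)))
        spread _ (at-c refl) = q₀ , q₁ , All.lookup (AllPairs.head Q!) (here refl)
          , (Q∌U q₀∈ , Q<N q₀∈ , c-adj (there q₀∈)) , (Q∌U q₁∈ , Q<N q₁∈ , c-adj (there q₁∈))
        spread _ (in-Q u∈Q) = y , c , c≢y ∘ sym
          , (y∉U , ns<N y∈ns , Adj-sym (y-adj u∈Q)) , (c∉U , c<N , Adj-sym (c-adj (there u∈Q)))
        spread u∉U (old u∈U) = contradiction u∈U u∉U

      O≤Q″ : length O ≤ length Q″
      O≤Q″ = ≤-trans O-size (≤-reflexive (trans |h|≡n (sym |Q″|)))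

      degrees : ∀ u → ∃[ L ] (∀ {v} → Adj F u v → v ∈ L) × length L ≤ Δ
      degrees u with u ≟ x | u ≟ y | u ≟ z | u ≟ c | u ∈? Q | u ∈? U
      ... | yes refl | _ | _ | _ | _ | _ = ns , x-nbrs ∘ link , ns≤Δ
      ... | no _ | yes u≡y | _ | _ | _ | _ =
            x ∷ Q , subst (λ u → ∀ {v} → Adj F u v → v ∈ x ∷ Q) (sym u≡y) (y-nbrs ∘ link)
            , s≤s (s≤s (s≤s (≤-reflexive |Q″|)))
        where
        y-nbrs : ∀ {v} → Link y v → v ∈ x ∷ Q
        y-nbrs (x-out y≡x _) = contradiction (sym y≡x) x≢y
        y-nbrs (x-in v≡x _)  = here v≡x
        y-nbrs (y-out _ v∈)  = there v∈
        y-nbrs (y-in _ y∈)   = contradiction refl (Q≢y y∈)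
        y-nbrs (c-out y≡c _) = contradiction (sym y≡c) c≢y
        y-nbrs (c-in _ y∈)   = contradiction refl (zQ≢y y∈)
        y-nbrs (zip-out p)   = contradiction (O⊆U (proj₁ (zip⁻ p))) y∉U
        y-nbrs (zip-in p)    = contradiction refl (Q≢y (proj₂ (zip⁻ p)))
        y-nbrs (past b)      = contradiction (Adj⇒∈U b) y∉U
      ... | no _ | no _ | yes refl | _ | _ | _ =
            x ∷ c ∷ [] , z-nbrs ∘ link , m≤m+n 2 (suc n)
        where
        z-nbrs : ∀ {v} → Link z v → v ∈ x ∷ c ∷ []
        z-nbrs (x-out z≡x _) = contradiction z≡x z≢x
        z-nbrs (x-in v≡x _)  = here v≡x
        z-nbrs (y-out z≡y _) = contradiction z≡y z≢y
        z-nbrs (y-in _ z∈)   = contradiction refl (Q≢z z∈)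
        z-nbrs (c-out z≡c _) = contradiction (sym z≡c) c≢z
        z-nbrs (c-in v≡c _)  = there (here v≡c)
        z-nbrs (zip-out p)   = contradiction (O⊆U (proj₁ (zip⁻ p))) z∉U
        z-nbrs (zip-in p)    = contradiction refl (Q≢z (proj₂ (zip⁻ p)))
        z-nbrs (past b)      = contradiction (Adj⇒∈U b) z∉U
      ... | no _ | no _ | no _ | yes refl | _ | _ =
            z ∷ Q , c-nbrs ∘ link , s≤s (s≤s (s≤s (≤-reflexive |Q″|)))
        where
        c-nbrs : ∀ {v} → Link c v → v ∈ z ∷ Q
        c-nbrs (x-out c≡x _) = contradiction c≡x c≢x
        c-nbrs (x-in _ c∈)   = contradiction c∈ c∉ns
        c-nbrs (y-out c≡y _) = contradiction c≡y c≢y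
        c-nbrs (y-in _ c∈)   = contradiction refl (Q≢c c∈)
        c-nbrs (c-out _ v∈)  = v∈
        c-nbrs (c-in _ c∈)   = contradiction refl (zQ≢c c∈)
        c-nbrs (zip-out p)   = contradiction (O⊆U (proj₁ (zip⁻ p))) c∉U
        c-nbrs (zip-in p)    = contradiction refl (Q≢c (proj₂ (zip⁻ p)))
        c-nbrs (past b)      = contradiction (Adj⇒∈U b) c∉U
      -- Listing all of `O` gives `3 + length O`, at most Δ for every n. Allowing one slot for a
      -- partner would give 4, too many when Δ = 3, where `O` is empty.
      ... | no u≢x | no u≢y | no _ | no u≢c | yes u∈Q | _ =
            x ∷ y ∷ c ∷ O , q-nbrs ∘ link , s≤s (s≤s (s≤s (≤-trans O≤Q″ (≤-reflexive |Q″|))))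
        where
        q-nbrs : ∀ {v} → Link u v → v ∈ x ∷ y ∷ c ∷ O
        q-nbrs (x-out u≡x _) = contradiction u≡x u≢x
        q-nbrs (x-in v≡x _)  = here v≡x
        q-nbrs (y-out u≡y _) = contradiction u≡y u≢y
        q-nbrs (y-in v≡y _)  = there (here v≡y)
        q-nbrs (c-out u≡c _) = contradiction u≡c u≢c
        q-nbrs (c-in v≡c _)  = there (there (here v≡c))
        q-nbrs (zip-out p)   = contradiction (O⊆U (proj₁ (zip⁻ p))) (Q∌U u∈Q)
        q-nbrs (zip-in p)    = there (there (there (proj₁ (zip⁻ p))))
        q-nbrs (past b)      = contradiction (Adj⇒∈U b) (Q∌U u∈Q)
      ... | no _ | no _ | no _ | no _ | no _ | yes u∈U with deg u∈U | u ∈? O | zip-partnerˡ Q″ O! u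
      ...   | L , cover , _ , spare | yes u∈O | P , P≤1 , partner =
              x ∷ P ++ L , old-nbrs ∘ U-nbrs u∈U ∘ link , (begin
                suc (length (P ++ L))       ≡⟨ cong suc (length-++ P) ⟩
                suc (length P + length L)   ≤⟨ s≤s (+-monoˡ-≤ (length L) P≤1) ⟩
                2 + length L                ≡⟨ +-comm 2 (length L) ⟩
                length L + 2                ≤⟨ spare u∈O ⟩
                Δ                           ∎)
        where
        open ≤-Reasoning
        old-nbrs : ∀ {v} → Adj E u v ⊎ (u ∈ O × (v ≡ x ⊎ (u , v) ∈ zip O Q″)) → v ∈ x ∷ P ++ L
        old-nbrs (inj₁ b)              = there (∈-++⁺ʳ P (cover b))
        old-nbrs (inj₂ (_ , inj₁ v≡x)) = here v≡x
        old-nbrs (inj₂ (_ , inj₂ p))   = there (∈-++⁺ˡ (partner p))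
      ...   | L , cover , L≤Δ , _ | no u∉O | _ =
              L , [ cover , (λ (u∈O , _) → contradiction u∈O u∉O) ]′ ∘ U-nbrs u∈U ∘ link , L≤Δ
      degrees u | no u≢x | no u≢y | no u≢z | no u≢c | no u∉Q | no u∉U =
            [] , (λ uv → ⊥-elim (nowhere (place (link uv)))) , z≤n
        where
        nowhere : Place u → ⊥
        nowhere (at-x p) = u≢x p
        nowhere (at-y p) = u≢y p
        nowhere (at-z p) = u≢z p
        nowhere (at-c p) = u≢c p
        nowhere (in-Q p) = u∉Q p
        nowhere (old p)  = u∉U p

      C : List ℕ
      C = c ∷ ends h′

      -- Used twice: it bounds every matching by the size of `C`, and it shows that the edges left
      -- between unmatched nodes form a star at `c`.
      covered : ∀ {u v} → Link u v → u ∈ C ⊎ v ∈ C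
      covered (x-out refl _) = inj₁ (there x∈K′)
      covered (x-in refl _)  = inj₂ (there x∈K′)
      covered (y-out u≡y _)  = inj₁ (there (subst (_∈ ends h′) (sym u≡y) y∈K′))
      covered (y-in v≡y _)   = inj₂ (there (subst (_∈ ends h′) (sym v≡y) y∈K′))
      covered (c-out refl _) = inj₁ (here refl)
      covered (c-in refl _)  = inj₂ (here refl)
      covered (zip-out p)    = inj₁ (there (K⊆K′ (O⊆K (proj₁ (zip⁻ p)))))
      covered (zip-in p)     = inj₂ (there (K⊆K′ (O⊆K (proj₁ (zip⁻ p)))))
      covered (past b)       = [ inj₁ ∘ there ∘ K⊆K′ , inj₂ ∘ there ∘ K⊆K′ ]′ (Adj-cov b)

      |h′|≡1+n : length h′ ≡ suc n
      |h′|≡1+n = trans length-h′ (cong suc |h|≡n)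

      |C| : length C ≡ 3 + 2 * n
      |C| = cong suc (trans (length-ends h′) (trans (cong (2 *_) |h′|≡1+n) (*-suc 2 n)))

      bound : ∀ f → length (runFrom A (graph N F) f h′) ≤ 2 + n
      bound f = ≤-trans (runFrom-star A (graph N F) f h′ c centre) (≤-reflexive (cong suc |h′|≡1+n))
        where
        centre : ∀ {u v} → v ∈ nbrs (graph N F) u → u ∉ ends h′ → v ∉ ends h′ → u ≡ c ⊎ v ≡ c
        centre v∈ u∉ v∉ with covered (link (proj₂ (∈-nbrs⁻ N F v∈)))
        ... | inj₁ (here p)  = inj₁ p
        ... | inj₁ (there p) = contradiction p u∉
        ... | inj₂ (here p)  = inj₂ p
        ... | inj₂ (there p) = contradiction p v∉

      pairs : Edges
      pairs = (x , z) ∷ (y , q₀) ∷ (c , q₁) ∷ zip O Q″ ++ M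

      rests : List ℕ
      rests = endpoints (zip O Q″ ++ M)

      rests⁻ : ∀ {v} → v ∈ rests → v ∈ U ⊎ v ∈ Q″
      rests⁻ v∈ with ∈-++⁻ (endpoints (zip O Q″)) (subst (_ ∈_) (concatMap-++ _ (zip O Q″) M) v∈)
      ... | inj₂ v∈M = inj₁ (proj₁ (M⊆U v∈M))
      ... | inj₁ v∈Z = [ inj₁ ∘ O⊆U , inj₂ ]′ (∈-endpoints-zip⁻ O Q″ v∈Z)

      rests∌ : ∀ {v} → v ∉ U → v ∉ Q″ → All (v ≢_) rests
      rests∌ v∉U v∉Q = All.tabulate λ w∈ v≡w →
        [ v∉U ∘ subst (_∈ U) (sym v≡w) , v∉Q ∘ subst (_∈ Q″) (sym v≡w) ]′ (rests⁻ w∈)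

      rests! : Unique rests
      rests! = subst Unique (sym (concatMap-++ _ (zip O Q″) M))
        (Unique.++⁺
          (endpoints-zip-unique O! (AllPairs.tail (AllPairs.tail Q!))
            (λ v∈O v∈Q → Q∌U (there (there v∈Q)) (O⊆U v∈O)))
            M! disj)
        where
        disj : ∀ {v} → ¬ (v ∈ endpoints (zip O Q″) × v ∈ endpoints M)
        disj (v∈Z , v∈M) = [ proj₂ (M⊆U v∈M) , (λ v∈Q → Q∌U (there (there v∈Q)) (proj₁ (M⊆U v∈M))) ]′
          (∈-endpoints-zip⁻ O Q″ v∈Z)

      pairs! : Unique (endpoints pairs)
      pairs! =
          (z≢x ∘ sym ∷ x≢y ∷ Q≢x q₀∈ ∘ sym ∷ c≢x ∘ sym ∷ Q≢x q₁∈ ∘ sym ∷ rests∌ x∉U (λ p → Q≢x (tl p) refl))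
        ∷ (z≢y ∷ Q≢z q₀∈ ∘ sym ∷ c≢z ∘ sym ∷ Q≢z q₁∈ ∘ sym ∷ rests∌ z∉U (λ p → Q≢z (tl p) refl))
        ∷ (Q≢y q₀∈ ∘ sym ∷ c≢y ∘ sym ∷ Q≢y q₁∈ ∘ sym ∷ rests∌ y∉U (λ p → Q≢y (tl p) refl))
        ∷ (Q≢c q₀∈ ∷ All.lookup (AllPairs.head Q!) (here refl)
            ∷ rests∌ (Q∌U q₀∈) (λ p → All.lookup (AllPairs.head Q!) (there p) refl))
        ∷ (Q≢c q₁∈ ∘ sym ∷ rests∌ c∉U (λ p → Q≢c (tl p) refl))
        ∷ rests∌ (Q∌U q₁∈) (λ p → All.lookup (AllPairs.head (AllPairs.tail Q!)) p refl)
        ∷ rests!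
        where
        q₀∈ : q₀ ∈ Q
        q₀∈ = here refl
        q₁∈ : q₁ ∈ Q
        q₁∈ = there (here refl)
        tl : ∀ {v} → v ∈ Q″ → v ∈ Q
        tl p = there (there p)

      IsEdge : ℕ × ℕ → Set
      IsEdge (a , b) = a ∈ V (graph N F) × b ∈ V (graph N F) × adj (graph N F) a b ≡ true

      edge : ∀ {a b} → a < N → b < N → Adj F a b → IsEdge (a , b)
      edge {a} {b} a<N b<N ab = ∈-upTo⁺ a<N , ∈-upTo⁺ b<N , dec-true (adj? F a b) ab

      pairs-edges : All IsEdge pairs
      pairs-edges = edge x<N (ns<N z∈ns) (x-adj z∈ns)
        ∷ edge (ns<N y∈ns) (Q<N (here refl)) (y-adj (here refl))
        ∷ edge c<N (Q<N (there (here refl))) (c-adj (there (there (here refl))))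
        ∷ All.tabulate (λ e∈ → rest-edge (∈-++⁻ (zip O Q″) e∈))
        where
        rest-edge : ∀ {a b} → (a , b) ∈ zip O Q″ ⊎ (a , b) ∈ M → IsEdge (a , b)
        rest-edge (inj₁ p) = edge (U<N a∈U) (Q<N b∈Q) ((λ a≡b → Q∌U b∈Q (subst (_∈ U) a≡b a∈U)) , inj₁ (zipF p))
          where
          a∈U = O⊆U (proj₁ (zip⁻ p))
          b∈Q = proj₂ (zip⁻ p)
        rest-edge (inj₂ p) = edge (U<N (proj₁ (E⊆U (proj₁ (M⊆E p))))) (U<N (proj₂ (E⊆U (proj₁ (M⊆E p)))))
          (proj₂ (M⊆E p) , inj₁ (E⊆F (proj₁ (M⊆E p))))

      -- The nodes of `O` now receive the edges they stood for. Since `O` is no longer than `Q″`,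
      -- zipping drops none of them, and `M-size` gives 2n edges besides the three new ones.
      |pairs| : length pairs ≡ 3 + 2 * n
      |pairs| = cong (3 +_) (begin
        length (zip O Q″ ++ M)          ≡⟨ length-++ (zip O Q″) ⟩
        length (zip O Q″) + length M    ≡⟨ cong (_+ length M) (length-zipWith _,_ O Q″) ⟩
        (length O ⊓ length Q″) + length M ≡⟨ cong (_+ length M) (m≤n⇒m⊓n≡m O≤Q″) ⟩
        length O + length M             ≡⟨ +-comm (length O) (length M) ⟩
        length M + length O             ≡⟨ M-size ⟩
        2 * length h                    ≡⟨ cong (2 *_) |h|≡n ⟩
        2 * n                           ∎)
        where open ≡-Reasoning

      outcome : Outcome h U O E
      outcome = F , extends , final , run-bound extends final xF (x-nbrs ∘ link) bound
        where
        final : Final F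
        final = record
          { degrees  = degrees
          ; matching = pairs , (pairs-edges , pairs!) , |pairs|
          ; cover    = C , covered ∘ link , |C|
          }

    R≤ : length R ≤ 2 + n
    R≤ = ≤-trans (m≤n+m _ 1) (s≤s⁻¹ (≤-trans rest≤ns ns≤Δ))

    -- The fresh neighbours `R` of `x` must be part of `Q`; this many new labels complete it to Δ -
    -- 1 nodes. The additional label in `room` is for `c`.
    pad : ℕ
    pad = 2 + n ∸ length R

    room : suc pad + length U′ ≤ N
    room = begin
      suc pad + suc (length (ns ++ U))           ≡⟨ cong (λ k → suc pad + suc k) (length-++ ns) ⟩
      suc pad + suc (length ns + length U)
        ≤⟨ +-mono-≤ (s≤s (m∸n≤m (2 + n) (length R))) (s≤s (+-monoˡ-≤ (length U) ns≤Δ)) ⟩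
      Δ + (suc Δ + length U)                     ≡⟨ +-comm Δ (suc Δ + length U) ⟩
      suc Δ + length U + Δ                       ≡⟨ cong (_+ Δ) (+-comm (suc Δ) (length U)) ⟩
      length U + suc Δ + Δ                       ≡⟨ +-assoc (length U) (suc Δ) Δ ⟩
      length U + (suc Δ + Δ)                     ≡⟨ cong (λ k → length U + (k + Δ)) (sym (*-identityˡ (suc Δ))) ⟩
      length U + (1 * suc Δ + Δ)                 ≤⟨ budget ⟩
      N                                          ∎
      where open ≤-Reasoning

    outcome : Outcome h U O E
    outcome = supply (fresh-labels N U′ (suc pad) room)
      where
      supply : ∃[ L ] length L ≡ suc pad × Unique L × (∀ {v} → v ∈ L → v < N × v ∉ U′) → Outcome h U O E
      supply (c ∷ L , |L| , (c# ∷ L!) , new) = split (R ++ L) refl |Q|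
        where
        |Q| : length (R ++ L) ≡ 2 + n
        |Q| = trans (length-++ R) (trans (cong (length R +_) (suc-injective |L|)) (m+[n∸m]≡n R≤))
        Q! : Unique (R ++ L)
        Q! = Unique.++⁺ (AllPairs.tail rest!) L!
          (λ (v∈R , v∈L) → proj₂ (new (there v∈L)) (ns⊆U′ (proj₁ (rest⁻ (there v∈R)))))
        Q-spec : ∀ {v} → v ∈ R ++ L → (v < N × v ∉ U) × v ≢ x × v ≢ y × v ≢ z × v ≢ c
        Q-spec v∈ with ∈-++⁻ R v∈
        ... | inj₁ v∈R = let v∈ns , v∉U , v≢y = rest⁻ (there v∈R) in
              (ns<N v∈ns , v∉U) , rest≢x (there v∈R) , v≢y
              , (λ v≡z → All.lookup (AllPairs.head rest!) v∈R (sym v≡z))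
              , (λ v≡c → proj₂ (new (here refl)) (subst (_∈ U′) v≡c (ns⊆U′ v∈ns)))
        ... | inj₂ v∈L = let v<N , v∉U′ = new (there v∈L) in
              (v<N , v∉U′ ∘ U⊆U′) , (λ v≡x → v∉U′ (here v≡x))
              , (λ v≡y → v∉U′ (ns⊆U′ (subst (_∈ ns) (sym v≡y) y∈ns)))
              , (λ v≡z → v∉U′ (ns⊆U′ (subst (_∈ ns) (sym v≡z) z∈ns)))
              , (λ v≡c → All.lookup c# v∈L (sym v≡c))
        split : ∀ Q → R ++ L ≡ Q → length Q ≡ 2 + n → Outcome h U O E
        split (q₀ ∷ q₁ ∷ Q″) eq |Q| = Finish.outcome c q₀ q₁ Q″ (proj₁ (new (here refl))) (proj₂ (new (here refl)))
          (suc-injective (suc-injective |Q|)) (subst Unique eq Q!) (λ v∈ → subst (_ ∈_) eq (∈-++⁺ˡ v∈))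
          (λ v∈ → Q-spec (subst (_ ∈_) (sym eq) v∈))

  -- Playing all rounds and reading off the ratio

  nextPick : ∀ {r h U O E M} → Invariant r h U O E M → Pick h U O
  nextPick {r} {h} {U} {O} inv = pick h U O K⊆U O⊆K (begin
    3 + length U                          ≡⟨ +-comm 3 (length U) ⟩
    length U + 3                          ≤⟨ +-monoʳ-≤ (length U) (m≤m+n 3 n) ⟩
    length U + Δ                          ≤⟨ +-monoʳ-≤ (length U) (m≤n+m Δ (suc r * suc Δ)) ⟩
    length U + (suc r * suc Δ + Δ)        ≤⟨ budget ⟩
    N                                     ∎)
    where
    open Invariant inv
    open ≤-Reasoning

  play : ∀ r {h U O E M} → Invariant r h U O E M → Outcome h U O E
  play zero    inv = Endgame.outcome inv (nextPick inv)
  play (suc r) inv = Mistake.advance inv (nextPick inv) (play r)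

module _ (n : ℕ) (A : GreedyAPA) where

  labels : ℕ
  -- Every round uses at most 1 + Δ labels, the last one another Δ.
  labels = suc n * (4 + n) + (3 + n)

  open Game n labels A

  start : Invariant n [] [] [] [] []
  start = record
    { U<N = λ () ; K⊆U = λ () ; O⊆K = λ () ; O! = [] ; E⊆U = λ () ; E-cov = λ () ; deg = λ ()
    ; M! = [] ; M⊆U = λ () ; M⊆E = λ () ; M-size = refl ; O-size = z≤n ; rounds = refl
    ; budget = ≤-refl
    }

  conclude : Outcome [] [] [] [] → ∃[ G ] (MaxDegree≤ G (3 + n) × ∃[ M ] (IsMaximumMatching G M × 1 ≤ length M
    × (2 * (3 + n) ∸ 3) * algMatchingSize A G ≤ (3 + n ∸ 1) * length M))
  conclude (F , _ , final , bound) with Final.matching final | Final.cover final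
  ... | M , isM , |M| | C , covers , |C| =
          graph labels F
          , All.tabulate (λ {u} _ → ≤-trans (degree-≤ labels F u (proj₁ (proj₂ (Final.degrees final u))))
                                            (proj₂ (proj₂ (Final.degrees final u))))
          , M , (isM , λ M′ isM′ → ≤-trans (matching-≤-cover labels F C covers M′ isM′)
                                           (≤-reflexive (trans |C| (sym |M|))))
          , subst (1 ≤_) (sym |M|) (s≤s z≤n)
          , (begin
              (2 * (3 + n) ∸ 3) * algMatchingSize A (graph labels F)
                ≤⟨ *-monoʳ-≤ (2 * (3 + n) ∸ 3) (bound (length (upTo labels))) ⟩
              (2 * (3 + n) ∸ 3) * (2 + n)  ≡⟨ cong (λ k → (k ∸ 3) * (2 + n)) (*-distribˡ-+ 2 3 n) ⟩
              (3 + 2 * n) * (2 + n)        ≡⟨ *-comm (3 + 2 * n) (2 + n) ⟩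
              (2 + n) * (3 + 2 * n)        ≡⟨ cong ((2 + n) *_) |M| ⟨
              (2 + n) * length M           ∎)
    where open ≤-Reasoning

theorem8 : (Δ : ℕ) → 3 ≤ Δ → (A : GreedyAPA) →
    ∃[ G ] (MaxDegree≤ G Δ × ∃[ M ] (IsMaximumMatching G M × 1 ≤ length M
    × (2 * Δ ∸ 3) * algMatchingSize A G ≤ (Δ ∸ 1) * length M))
theorem8 (suc (suc (suc n))) (s≤s (s≤s (s≤s z≤n))) A = conclude n A (Game.play n (labels n A) A n (start n A))
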